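{- Let $\vec c=(c_1,\dots,c_k)$ be a composition of $n$ with $c_k>0$. The cycles $g_\alpha=\sum_{\gamma\in\mathfrak S^c_{\vec c}}(-1)^{\gamma}\,\sigma(\alpha\circ\gamma,\vec c)$, where $\alpha$ ranges over all permutations in $\mathfrak S_n$ with descent composition $\vec c$, form a basis for the homology group $\widetilde H_{k-2}(\Delta_{\vec c})$.
   Context: A pointed composition of $n$ is $(c_1,\dots,c_k)$ with $c_1,\dots,c_{k-1}\ge1$, $c_k\ge0$, sum $n$, ordered by $\vec c\le\vec d$ iff $\vec d$ is obtained from $\vec c$ by replacing runs of consecutive entries by their sums. An ordered set partition of $[n]$ is $(C_1,\dots,C_r)$, pairwise disjoint with union $[n]$, $C_1,\dots,C_{r-1}$ nonempty, $C_r$ possibly empty; type $(|C_1|,\dots,|C_r|)$. $\Delta_n$ is the simplicial complex with these faces ($(C_1,\dots,C_r)$ of dimension $r-2$, faces obtained by merging consecutive blocks, $([n])$ the empty face), and $\Delta_{\vec c}=\{\tau\in\Delta_n:\vec c\le\operatorname{type}(\tau)\}$. The chain group $C_j(\Delta_{\vec c})$ is free on the faces of dimension $j$, with boundary $\partial(C_1,\dots,C_r)=\sum_{i=1}^{r-1}(-1)^{i-1}(C_1,\dots,C_i\cup C_{i+1},\dots,C_r)$; $\widetilde H$ is reduced homology (coefficients in a fixed field). For $\alpha=\alpha_1\cdots\alpha_n$, $\sigma(\alpha,\vec c)=(\{\alpha_j:j\in R_1\},\dots,\{\alpha_j:j\in R_k\})$ with $R_i=[c_1+\dots+c_{i-1}+1,c_1+\dots+c_i]$;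 $\alpha\circ\gamma$ is $j\mapsto\alpha_{\gamma(j)}$; $(-1)^\gamma$ is the sign of $\gamma$. The descent composition of $\alpha$ with descent set $\{i:\alpha_i>\alpha_{i+1}\}=\{s_1<\dots<s_{k-1}\}$ is $(s_1,s_2-s_1,\dots,n-s_{k-1})$. The column intervals $K_1,\dots,K_{n-k+1}$ of $\vec c$ are the maximal intervals of $[n]$ such that $j$ and $j+1$ lie in the same interval iff $j\in\{c_1,c_1+c_2,\dots,c_1+\dots+c_{k-1}\}$; $\mathfrak S^c_{\vec c}=\mathfrak S_{K_1}\times\cdots\times\mathfrak S_{K_{n-k+1}}$. -}

module Defs where

open import Level using (Level; _⊔_) renaming (suc to lsuc)
open import Algebra.Bundles using (CommutativeRing)
open import Data.Nat as ℕ using (ℕ; zero; suc; _∸_; _<?_; NonZero)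
open import Data.Fin as Fin using (Fin; toℕ; pinch)
open import Data.Fin.Properties using (all?)
import Data.Fin.Properties as FinP
open import Data.Vec as Vec using (Vec; []; _∷_; lookup)
import Data.Vec.Properties as VecP
open import Data.List as List using (List; []; _∷_; concatMap; filter; length)
open import Data.Nat.ListAction using (sum)
open import Data.List.Membership.Propositional using (_∈_)
open import Data.List.Membership.DecPropositional ℕ._≟_ using (_∈?_)
open import Data.Product using (Σ; ∃; _×_; _,_)
open import Relation.Nullary using (¬_; Dec; yes; no; _→-dec_; ¬?)
open import Relation.Nullary.Decidable using (_×-dec_; ⌊_⌋)
open import Data.Bool using (if_then_else_)
open import Relation.Binary.PropositionalEquality using (_≡_)

record Field (c ℓ : Level) : Set (lsuc (c ⊔ ℓ)) where
  field
    commutativeRing : CommutativeRing c ℓ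
  open CommutativeRing commutativeRing public
  field
    0≉1     : ¬ (0# ≈ 1#)
    inverse : ∀ x → ¬ (x ≈ 0#) → Σ Carrier λ y → (x * y) ≈ 1#

-- Compositions and the refinement order (merging runs of consecutive
-- entries).  `Coarsens c d` : d is obtained from c by replacing runs of
-- consecutive entries by their sums, i.e. c ≤ d.

data Coarsens : List ℕ → List ℕ → Set where
  done  : Coarsens [] []
  new   : ∀ {x cs ds} → Coarsens cs ds → Coarsens (x ∷ cs) (x ∷ ds)
  merge : ∀ {x d cs ds} → Coarsens cs (d ∷ ds) → Coarsens (x ∷ cs) ((x ℕ.+ d) ∷ ds)

IsPositiveComposition : ℕ → List ℕ → Set
IsPositiveComposition n c = (¬ (c ≡ [])) × (sum c ≡ n) × AllPos c
  where
  AllPos : List ℕ → Set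
  AllPos [] = Data.Unit.⊤ where import Data.Unit
  AllPos (x ∷ xs) = (0 ℕ.< x) × AllPos xs

-- Ordered set partitions of [n] = {0,…,n-1} into r blocks, encoded as
-- block-assignment vectors a : Vec (Fin r) n (element m lies in block
-- `lookup a m`).  Blocks 0,…,r-2 must be nonempty; block r-1 may be empty.
-- Such a partition with r blocks is a face of dimension r - 2.

OSP : ℕ → ℕ → Set
OSP n r = Vec (Fin r) n

blockSize : ∀ {n r} → OSP n r → Fin r → ℕ
blockSize a i = Vec.count (λ x → x Fin.≟ i) a

typeOf : ∀ {n r} → OSP n r → List ℕ
typeOf {r = r} a = List.map (blockSize a) (List.allFin r)

IsOSP : ∀ {n r} → OSP n r → Set
IsOSP {r = r} a = ∀ (i : Fin r) → suc (toℕ i) ℕ.< r → 0 ℕ.< blockSize a i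

InΔ : (c : List ℕ) → ∀ {n r} → OSP n r → Set
InΔ c a = IsOSP a × Coarsens c (typeOf a)

allVecs : ∀ {A : Set} → List A → (n : ℕ) → List (Vec A n)
allVecs xs zero    = [] ∷ []
allVecs xs (suc n) = concatMap (λ x → List.map (x ∷_) (allVecs xs n)) xs

allOSP : (n r : ℕ) → List (OSP n r)
allOSP n r = allVecs (List.allFin r) n

IsPerm : ∀ {n} → Vec (Fin n) n → Set
IsPerm α = ∀ i j → lookup α i ≡ lookup α j → i ≡ j

isPerm? : ∀ {n} (α : Vec (Fin n) n) → Dec (IsPerm α)
isPerm? α = all? λ i → all? λ j → (lookup α i Fin.≟ lookup α j) →-dec (i Fin.≟ j)

allPerms : (n : ℕ) → List (Vec (Fin n) n)
allPerms n = filter isPerm? (allOSP n n)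

_∘ₚ_ : ∀ {n} → Vec (Fin n) n → Vec (Fin n) n → Vec (Fin n) n
α ∘ₚ γ = Vec.map (lookup α) γ

inversions : ∀ {n} → Vec (Fin n) n → ℕ
inversions {n} γ =
  length (filter (λ (p : Fin n × Fin n) → let (i , j) = p in
                    (i Fin.<? j) ×-dec (lookup γ j Fin.<? lookup γ i))
                 (List.cartesianProduct (List.allFin n) (List.allFin n)))

-- descents: positions p (1-indexed) with α_p > α_{p+1}; `pos` is the
-- 1-indexed position of the head of the word
descentsFrom : ℕ → List ℕ → List ℕ
descentsFrom pos []           = []
descentsFrom pos (x ∷ [])     = []
descentsFrom pos (x ∷ y ∷ ys) =
  let rest = descentsFrom (suc pos) (y ∷ ys) in
  if ⌊ y <? x ⌋ then pos ∷ rest else rest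

gaps : (n prev : ℕ) → List ℕ → List ℕ
gaps n prev []       = (n ∸ prev) ∷ []
gaps n prev (s ∷ ss) = (s ∸ prev) ∷ gaps n s ss

descentComposition : ∀ {n} → Vec (Fin n) n → List ℕ
descentComposition {n} α =
  gaps n 0 (descentsFrom 1 (Vec.toList (Vec.map toℕ α)))

-- index (0-based) of the block R_i containing 0-indexed position j
rowOf : List ℕ → ℕ → ℕ
rowOf []       j = 0
rowOf (x ∷ cs) j with j <? x
... | yes _ = 0
... | no  _ = suc (rowOf cs (j ∸ x))

partialSums : List ℕ → List ℕ
partialSums []       = []
partialSums (x ∷ []) = []
partialSums (x ∷ y ∷ cs) = x ∷ List.map (x ℕ.+_) (partialSums (y ∷ cs))

-- index of the column interval containing 1-indexed position p:
-- number of j ∈ [1, p-1] at which the interval breaks (j ∉ partial sums)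
colOf : List ℕ → ℕ → ℕ
colOf c p = length (filter (λ j → ¬? (j ∈? partialSums c))
                           (List.map suc (List.upTo (p ∸ 1))))

InYoung : ∀ {n} → List ℕ → Vec (Fin n) n → Set
InYoung c γ = ∀ j → colOf c (suc (toℕ (lookup γ j))) ≡ colOf c (suc (toℕ j))

inYoung? : ∀ {n} (c : List ℕ) (γ : Vec (Fin n) n) → Dec (InYoung c γ)
inYoung? c γ = all? λ j → colOf c (suc (toℕ (lookup γ j))) ℕ.≟ colOf c (suc (toℕ j))

youngSubgroup : (n : ℕ) → List ℕ → List (Vec (Fin n) n)
youngSubgroup n c = filter (inYoung? c) (allPerms n)

withDescentComposition : (n : ℕ) → List ℕ → List (Vec (Fin n) n)
withDescentComposition n c =
  filter (λ α → VecListEq (descentComposition α) c) (allPerms n)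
  where
  open import Data.List.Properties using (≡-dec)
  VecListEq : (x y : List ℕ) → Dec (x ≡ y)
  VecListEq = ≡-dec ℕ._≟_

-- σ(β, c) = b  :  block i of b is {β_j : j ∈ R_i}, i.e. every β_j lies in
-- the block of b indexed by the row of j
IsSigma : ∀ {n r} → Vec (Fin n) n → List ℕ → OSP n r → Set
IsSigma β c b = ∀ j → toℕ (lookup b (lookup β j)) ≡ rowOf c (toℕ j)

isSigma? : ∀ {n r} (β : Vec (Fin n) n) (c : List ℕ) (b : OSP n r) → Dec (IsSigma β c b)
isSigma? β c b = all? λ j → toℕ (lookup b (lookup β j)) ℕ.≟ rowOf c (toℕ j)

module _ {c ℓ : Level} (F : Field c ℓ) where
  open Field F

  Σ[_]_ : ∀ {A : Set} → List A → (A → Carrier) → Carrier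
  Σ[ xs ] f = List.foldr (λ x s → f x + s) 0# xs

  ind : ∀ {P : Set} → Dec P → Carrier
  ind (yes _) = 1#
  ind (no  _) = 0#

  signPow : ℕ → Carrier
  signPow zero    = 1#
  signPow (suc m) = - signPow m

  sign : ∀ {n} → Vec (Fin n) n → Carrier
  sign γ = signPow (inversions γ)

  -- a chain on faces with r blocks: formal linear combination, given by
  -- its coefficient function
  Chain : ℕ → ℕ → Set c
  Chain n r = OSP n r → Carrier

  IsChainOf : (cc : List ℕ) → ∀ {n r} → Chain n r → Set ℓ
  IsChainOf cc x = ∀ a → ¬ InΔ cc a → x a ≈ 0#

  _≈ᶜ_ : ∀ {n r} → Chain n r → Chain n r → Set ℓ
  x ≈ᶜ y = ∀ a → x a ≈ y a

  -- boundary ∂ : C_{r-1} → C_{r-2} (faces with r+1 blocks to faces with r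
  -- blocks): ∂(C_1,…,C_{r+1}) = Σ_{i=1}^{r} (-1)^{i-1} (…, C_i ∪ C_{i+1}, …);
  -- merging 0-indexed blocks i, i+1 is `pinch i`.
  ∂ : ∀ {n r} → Chain n (suc r) → Chain n r
  ∂ {n} {r} x b =
    Σ[ allOSP n (suc r) ] λ a →
      Σ[ List.allFin r ] λ i →
        signPow (toℕ i) * ind (VecP.≡-dec Fin._≟_ (Vec.map (pinch i) a) b) * x a

  -- ∂ on chains with r blocks (to r ∸ 1 blocks); r = 0 never occurs for
  -- the faces considered below (k ≥ 1), it is set to 0 there
  ∂↓ : ∀ {n r} → Chain n r → Chain n (r ∸ 1)
  ∂↓ {r = zero}  x = λ _ → 0#
  ∂↓ {r = suc r} x = ∂ x

  g : ∀ {n} (cc : List ℕ) → Vec (Fin n) n → Chain n (length cc)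
  g {n} cc α b =
    Σ[ youngSubgroup n cc ] λ γ → sign γ * ind (isSigma? (α ∘ₚ γ) cc b)

  combo : ∀ {n} (cc : List ℕ) → (Vec (Fin n) n → Carrier) → Chain n (length cc)
  combo {n} cc λc b = Σ[ withDescentComposition n cc ] λ α → λc α * g cc α b

  _-ᶜ_ : ∀ {n r} → Chain n r → Chain n r → Chain n r
  (x -ᶜ y) a = x a - y a

  IsBoundary : (cc : List ℕ) → ∀ {n r} → Chain n r → Set (c ⊔ ℓ)
  IsBoundary cc {n} {r} z = Σ (Chain n (suc r)) λ w → IsChainOf cc w × (∂ w ≈ᶜ z)

  -- the classes [g_α] (α with descent composition c) form a basis of
  -- H̃_{k-2}(Δ_c) = Z_{k-2}/B_{k-2}, k = length c
  IsHomologyBasis : (n : ℕ) (cc : List ℕ) → Set (c ⊔ ℓ)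
  IsHomologyBasis n cc =
    (∀ α → α ∈ withDescentComposition n cc →
       IsChainOf cc (g cc α) × (∂↓ (g cc α) ≈ᶜ (λ _ → 0#)))
    × (∀ (z : Chain n (length cc)) → IsChainOf cc z → ∂↓ z ≈ᶜ (λ _ → 0#) →
         Σ (Vec (Fin n) n → Carrier) λ λc → IsBoundary cc (z -ᶜ combo cc λc))
    × (∀ (λc : Vec (Fin n) n → Carrier) → IsBoundary cc (combo cc λc) →
         ∀ α → α ∈ withDescentComposition n cc → λc α ≈ 0#)

{-# OPTIONS --safe #-}
-- The complex has no faces with more than k = length cc blocks, so the homology in question is the
-- space of top cycles.  Order the faces of type cc lexicographically, reading the block of the
-- largest element first.  For α with descent composition cc, the leading (smallest) face of g α is
-- σ(α, cc), with coefficient 1, and these leading faces are distinct: the g α are unitriangular.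
-- A face b of type cc that is not such a leading face has consecutive blocks with
-- max Cᵢ < min Cᵢ₊₁; the cycle condition at the face merging them expresses the coefficient of b
-- through coefficients of smaller faces.  Hence a cycle that vanishes on all leading faces is zero,
-- and solving the unitriangular system gives both spanning and independence.  That g α is a cycle
-- follows by pairing γ with γ composed with the transposition of the last position of row i and the
-- first position of row i + 1.
module Submission where

open import Defs
open import Level using (Level)
open import Algebra.Bundles using (CommutativeMonoid)
import Algebra.Properties.CommutativeSemigroup as CommutativeSemigroupProperties
import Algebra.Properties.Ring as RingProperties
open import Data.Nat as ℕ using (ℕ; zero; suc; _+_; _*_; _∸_; _≤_; _<_; z≤n; s≤s; z<s; s<s)
import Data.Nat.Properties as ℕ
open import Data.Nat.ListAction using (sum)
open import Data.Fin as Fin using (Fin; zero; suc; toℕ; pinch)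
import Data.Fin.Properties as Fin
open import Data.Vec as Vec using (Vec; []; _∷_; lookup; tabulate)
import Data.Vec.Properties as Vec
open import Data.List as List using (List; []; _∷_; length; filter; allFin; cartesianProduct)
import Data.List.Properties as List
open import Data.List.Membership.Propositional using (_∈_; _∉_)
import Data.List.Membership.Propositional.Properties as ∈
open import Data.List.Membership.DecPropositional ℕ._≟_ using (_∈?_)
open import Data.List.Relation.Unary.Any as Any using (here; there)
open import Data.List.Relation.Unary.All as All using (All; []; _∷_)
import Data.List.Relation.Unary.All.Properties as All
import Data.List.Relation.Unary.AllPairs as AllPairs
import Data.List.Relation.Unary.AllPairs.Properties as AllPairs
open import Data.List.Relation.Unary.Unique.Propositional using (Unique; []; _∷_)
import Data.List.Relation.Unary.Unique.Propositional.Properties as Unique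
open import Data.Product using (∃; _×_; _,_; proj₁; proj₂)
import Data.Product.Properties as Product
open import Data.Sum using (_⊎_; inj₁; inj₂)
open import Function using (_∘_; id)
open import Relation.Binary using (DecidableEquality; tri<; tri≈; tri>)
open import Relation.Binary.PropositionalEquality
  using (_≡_; _≢_; refl; sym; trans; cong; cong₂; subst; subst₂; ≢-sym; module ≡-Reasoning)
open import Relation.Nullary using (¬_; Dec; yes; no; contradiction; ¬?)
open import Relation.Nullary.Decidable using (_×-dec_)

-- The largest element is read first because it decides both comparisons. Down a column of `α` the
-- entries decrease, so an element can reach an earlier row only by evicting a larger one. And if
-- max Cᵢ < min Cᵢ₊₁, then any other division of the same union into the same sizes moves some large
-- element to the earlier block.
--
-- A face without such a pair of blocks is a leading face for this reason: write each block in
-- increasing order and concatenate. The word increases inside the blocks and, by assumption,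
-- descends at every border, so its descent composition is `cc`.
--
-- Positivity of the last entry provides the first position of the last row, on which the
-- transposition at the last border acts.
--
-- Equality in the field is not assumed decidable. The triangular system is therefore solved by
-- explicit substitution along a natural-number key, with no count of dimensions.

positive : ∀ {n} c → IsPositiveComposition n c → All (0 <_) c
positive []              _               = []
positive (x ∷ [])        (_ , _ , p , _) = p ∷ []
-- The local predicate `AllPos` is reached only through `IsPositiveComposition`, so the tail is
-- repackaged as a composition of its own sum.
positive (x ∷ c@(_ ∷ _)) (_ , _ , p , q) = p ∷ positive c ((λ ()) , refl {x = sum c} , q)

-- Finite sums over lists in a commutative monoid

module ListSum {a ℓ : Level} (M : CommutativeMonoid a ℓ) where
  open CommutativeMonoid M renaming (refl to ≈-refl; sym to ≈-sym; trans to ≈-trans)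
  open CommutativeSemigroupProperties commutativeSemigroup using (interchange)
  open import Relation.Binary.Reasoning.Setoid setoid

  private variable
    A B : Set
    xs : List A
    ys : List B
    f h : A → Carrier

  ∑ : List A → (A → Carrier) → Carrier
  ∑ xs f = List.foldr (λ x s → f x ∙ s) ε xs

  ∑-cong : ∀ (xs : List A) → (∀ x → x ∈ xs → f x ≈ h x) → ∑ xs f ≈ ∑ xs h
  ∑-cong []       eq = ≈-refl
  ∑-cong (x ∷ xs) eq = ∙-cong (eq x (here refl)) (∑-cong xs λ y y∈ → eq y (there y∈))

  ∑-ε : ∀ (xs : List A) → (∀ x → x ∈ xs → f x ≈ ε) → ∑ xs f ≈ ε
  ∑-ε []       eq = ≈-refl
  ∑-ε (x ∷ xs) eq =
    ≈-trans (∙-cong (eq x (here refl)) (∑-ε xs λ y y∈ → eq y (there y∈))) (identityˡ ε)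

  ∑-∙ : ∀ (xs : List A) f h → ∑ xs (λ x → f x ∙ h x) ≈ ∑ xs f ∙ ∑ xs h
  ∑-∙ []       f h = ≈-sym (identityˡ ε)
  ∑-∙ (x ∷ xs) f h = ≈-trans (∙-congˡ (∑-∙ xs f h)) (interchange _ _ _ _)

  ∑-swap : ∀ (xs : List A) (ys : List B) (h : A → B → Carrier) →
           ∑ xs (λ x → ∑ ys (h x)) ≈ ∑ ys (λ y → ∑ xs (λ x → h x y))
  ∑-swap []       ys h = ≈-sym (∑-ε ys λ _ _ → ≈-refl)
  ∑-swap (x ∷ xs) ys h =
    ≈-trans (∙-congˡ (∑-swap xs ys h)) (≈-sym (∑-∙ ys (h x) (λ y → ∑ xs (λ x → h x y))))

  ∑-single : Unique xs → ∀ {y} → y ∈ xs → (∀ x → x ∈ xs → x ≢ y → f x ≈ ε) → ∑ xs f ≈ f y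
  ∑-single (x∉ ∷ _) (here refl) eq =
    ≈-trans (∙-congˡ (∑-ε _ λ z z∈ → eq z (there z∈) (≢-sym (All.lookup x∉ z∈)))) (identityʳ _)
  ∑-single (x∉ ∷ u) (there y∈) eq =
    ≈-trans (∙-cong (eq _ (here refl) (All.lookup x∉ y∈)) (∑-single u y∈ λ z z∈ → eq z (there z∈)))
            (identityˡ _)

  -- Both sides equal a double sum over `xs` and `ys` supported on the graph of `to`; each of its
  -- rows and columns keeps a single term. This needs no reasoning about permuted lists.
  ∑-bijection : DecidableEquality B → Unique xs → Unique ys →
    (to : A → B) (from : B → A) →
    (∀ x → x ∈ xs → to x ∈ ys) → (∀ y → y ∈ ys → from y ∈ xs) →
    (∀ x → from (to x) ≡ x) → (∀ y → y ∈ ys → to (from y) ≡ y) →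
    ∀ f → ∑ xs (f ∘ to) ≈ ∑ ys f
  ∑-bijection {B = B} {xs = xs} {ys = ys} _≟_ uxs uys to from to∈ from∈ from-to to-from f = begin
    ∑ xs (f ∘ to)                        ≈⟨ ∑-cong xs (λ x x∈ → ≈-sym (row x x∈)) ⟩
    ∑ xs (λ x → ∑ ys (λ y → δ (to x) y)) ≈⟨ ∑-swap xs ys _ ⟩
    ∑ ys (λ y → ∑ xs (λ x → δ (to x) y)) ≈⟨ ∑-cong ys column ⟩
    ∑ ys f                               ∎
    where
    δ : B → B → Carrier
    δ z y with z ≟ y
    ... | yes _ = f y
    ... | no  _ = ε
    δ-≡ : ∀ {z y} → z ≡ y → δ z y ≈ f y
    δ-≡ {z} {y} eq with z ≟ y
    ... | yes _ = ≈-refl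
    ... | no ne = contradiction eq ne
    δ-≢ : ∀ {z y} → z ≢ y → δ z y ≈ ε
    δ-≢ {z} {y} ne with z ≟ y
    ... | yes eq = contradiction eq ne
    ... | no _   = ≈-refl
    row : ∀ x → x ∈ xs → ∑ ys (δ (to x)) ≈ f (to x)
    row x x∈ = ≈-trans (∑-single uys (to∈ x x∈) λ y _ ne → δ-≢ (≢-sym ne)) (δ-≡ refl)
    column : ∀ y → y ∈ ys → ∑ xs (λ x → δ (to x) y) ≈ f y
    column y y∈ =
      ≈-trans (∑-single uxs (from∈ y y∈)
                 λ x _ ne → δ-≢ λ eq → ne (trans (sym (from-to x)) (cong from eq)))
              (δ-≡ (to-from y y∈))

  ∑-allFin-suc : ∀ {n} (f : Fin (suc n) → Carrier) →
                 ∑ (allFin (suc n)) f ≡ f zero ∙ ∑ (allFin n) (f ∘ suc)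
  ∑-allFin-suc {n} f = cong (f zero ∙_)
    (trans (cong (λ xs → ∑ xs f) (sym (List.map-tabulate id suc))) (∑-map (allFin n)))
    where
    ∑-map : ∀ xs → ∑ (List.map suc xs) f ≡ ∑ xs (f ∘ suc)
    ∑-map []       = refl
    ∑-map (x ∷ xs) = cong (f (suc x) ∙_) (∑-map xs)

-- Enumerations of vectors, and permutations as vectors

allVecs-∈ : ∀ {A : Set} {xs : List A} {n} (v : Vec A n) → (∀ x → x ∈ xs) → v ∈ allVecs xs n
allVecs-∈ []      all∈ = here refl
allVecs-∈ (x ∷ v) all∈ =
  ∈.∈-concatMap⁺ _ (Any.map (λ { refl → ∈.∈-map⁺ _ (allVecs-∈ v all∈) }) (all∈ x))

allVecs-unique : ∀ {A : Set} {xs : List A} → Unique xs → ∀ n → Unique (allVecs xs n)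
allVecs-unique u zero    = [] ∷ []
allVecs-unique u (suc n) = Unique.concat⁺
  (All.map⁺ (All.universal (λ x → Unique.map⁺ Vec.∷-injectiveʳ (allVecs-unique u n)) _))
  (AllPairs.map⁺ (AllPairs.map heads-differ u))
  where
  heads-differ : ∀ {x y} → x ≢ y → ∀ {v} →
    ¬ (v ∈ List.map (x ∷_) (allVecs _ n) × v ∈ List.map (y ∷_) (allVecs _ n))
  heads-differ x≢y (v∈ , v∈′) with ∈.∈-map⁻ _ v∈ | ∈.∈-map⁻ _ v∈′
  ... | _ , _ , refl | _ , _ , eq = x≢y (Vec.∷-injectiveˡ eq)

allOSP-∈ : ∀ {n r} (a : OSP n r) → a ∈ allOSP n r
allOSP-∈ a = allVecs-∈ a ∈.∈-allFin

allOSP-unique : ∀ n r → Unique (allOSP n r)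
allOSP-unique n r = allVecs-unique (Unique.allFin⁺ r) n

vec-ext : ∀ {A : Set} {n} {u v : Vec A n} → (∀ i → lookup u i ≡ lookup v i) → u ≡ v
vec-ext {u = []}    {[]}    eq = refl
vec-ext {u = x ∷ u} {y ∷ v} eq = cong₂ _∷_ (eq zero) (vec-ext (eq ∘ suc))

-- Pigeonhole: punching out a missed value `m` would inject `Fin (suc n)` into `Fin n`.
injective⇒surjective : ∀ {n} (f : Fin n → Fin n) → (∀ i j → f i ≡ f j → i ≡ j) →
                       ∀ m → ∃ λ j → f j ≡ m
injective⇒surjective {suc n} f inj m with Fin.any? (λ j → f j Fin.≟ m)
... | yes hit = hit
... | no miss = contradiction
  (Fin.injective⇒≤ {f = λ j → Fin.punchOut (m≢f j)}
    λ {i} {j} eq → inj i j (Fin.punchOut-injective (m≢f i) (m≢f j) eq)) ℕ.1+n≰n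
  where
  m≢f : ∀ j → m ≢ f j
  m≢f j eq = miss (j , sym eq)

-- The position of m in β, with junk value m if m does not occur.
position : ∀ {n} → Vec (Fin n) n → Fin n → Fin n
position β m with Fin.any? (λ j → lookup β j Fin.≟ m)
... | yes (j , _) = j
... | no _        = m

module _ {n : ℕ} (β : Vec (Fin n) n) (perm : IsPerm β) where
  lookup-position : ∀ m → lookup β (position β m) ≡ m
  lookup-position m with Fin.any? (λ j → lookup β j Fin.≟ m)
  ... | yes (_ , eq) = eq
  ... | no miss      = contradiction (injective⇒surjective (lookup β) perm m) miss

  position-lookup : ∀ j → position β (lookup β j) ≡ j
  position-lookup j = perm _ _ (lookup-position (lookup β j))

lookup-∘ₚ : ∀ {n} (α γ : Vec (Fin n) n) j → lookup (α ∘ₚ γ) j ≡ lookup α (lookup γ j)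
lookup-∘ₚ α γ j = Vec.lookup-map j (lookup α) γ

∘ₚ-perm : ∀ {n} (α γ : Vec (Fin n) n) → IsPerm α → IsPerm γ → IsPerm (α ∘ₚ γ)
∘ₚ-perm α γ pα pγ i j eq =
  pγ i j (pα _ _ (trans (sym (lookup-∘ₚ α γ i)) (trans eq (lookup-∘ₚ α γ j))))

-- Counting by sums of zeros and ones

module ℕ-Sum where
  open ListSum ℕ.+-0-commutativeMonoid public

  ∑-mono-≤ : ∀ {A : Set} (xs : List A) {f g : A → ℕ} → (∀ x → f x ≤ g x) → ∑ xs f ≤ ∑ xs g
  ∑-mono-≤ []       le = z≤n
  ∑-mono-≤ (x ∷ xs) le = ℕ.+-mono-≤ (le x) (∑-mono-≤ xs le)

  ∑-mono-< : ∀ {A : Set} (xs : List A) {f g : A → ℕ} → (∀ x → f x ≤ g x) →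
             ∀ {y} → y ∈ xs → f y < g y → ∑ xs f < ∑ xs g
  ∑-mono-< (_ ∷ xs) le (here refl) lt = ℕ.+-mono-<-≤ lt (∑-mono-≤ xs le)
  ∑-mono-< (_ ∷ xs) le (there y∈)  lt = ℕ.+-mono-≤-< (le _) (∑-mono-< xs le y∈ lt)

  -- The Iverson bracket. Block sizes, ranks and inversion numbers become sums of it, so they can be
  -- reindexed and compared term by term.
  [_] : ∀ {P : Set} → Dec P → ℕ
  [ yes _ ] = 1
  [ no _ ]  = 0

  []-yes : ∀ {P : Set} (d : Dec P) → P → [ d ] ≡ 1
  []-yes (yes _) _ = refl
  []-yes (no ¬p) p = contradiction p ¬p

  []-no : ∀ {P : Set} (d : Dec P) → ¬ P → [ d ] ≡ 0
  []-no (yes p) ¬p = contradiction p ¬p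
  []-no (no _)  _  = refl

  []-⇔ : ∀ {P Q : Set} (d : Dec P) (e : Dec Q) → (P → Q) → (Q → P) → [ d ] ≡ [ e ]
  []-⇔ d (yes q) to from = []-yes d (from q)
  []-⇔ d (no ¬q) to from = []-no d (¬q ∘ to)

  []-mono : ∀ {P Q : Set} (d : Dec P) (e : Dec Q) → (P → Q) → [ d ] ≤ [ e ]
  []-mono (yes p) e to = ℕ.≤-reflexive (sym ([]-yes e (to p)))
  []-mono (no _)  e to = z≤n

  length-filter : ∀ {A : Set} {P : A → Set} (P? : ∀ x → Dec (P x)) xs →
                  length (filter P? xs) ≡ ∑ xs (λ x → [ P? x ])
  length-filter P? []       = refl
  length-filter P? (x ∷ xs) with P? x
  ... | yes _ = cong suc (length-filter P? xs)
  ... | no _  = length-filter P? xs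

  count-∑ : ∀ {A : Set} {P : A → Set} (P? : ∀ x → Dec (P x)) {n} (v : Vec A n) →
            Vec.count P? v ≡ ∑ (allFin n) (λ m → [ P? (lookup v m) ])
  count-∑ P? []                = refl
  count-∑ P? {suc n} (x ∷ v) =
    trans step (sym (∑-allFin-suc {n} (λ m → [ P? (lookup (x ∷ v) m) ])))
    where
    step : Vec.count P? (x ∷ v) ≡ [ P? x ] + ∑ (allFin n) (λ m → [ P? (lookup v m) ])
    step with P? x
    ... | yes _ = cong suc (count-∑ P? v)
    ... | no _  = count-∑ P? v

  ∑-1 : ∀ n → ∑ (allFin n) (λ _ → 1) ≡ n
  ∑-1 zero    = refl
  ∑-1 (suc n) = trans (∑-allFin-suc {n} (λ _ → 1)) (cong suc (∑-1 n))

-- Rows, columns and descents of a composition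

nth : List ℕ → ℕ → ℕ
nth []       _       = 0
nth (x ∷ _)  zero    = x
nth (_ ∷ xs) (suc i) = nth xs i

sum-take-suc : ∀ c i → sum (List.take (suc i) c) ≡ sum (List.take i c) + nth c i
sum-take-suc []       zero    = refl
sum-take-suc []       (suc i) = refl
sum-take-suc (x ∷ c)  zero    = ℕ.+-identityʳ x
sum-take-suc (x ∷ c)  (suc i) =
  trans (cong (x +_) (sum-take-suc c i)) (sym (ℕ.+-assoc x (sum (List.take i c)) (nth c i)))

split : ∀ x j → j < x ⊎ ∃ λ d → j ≡ x + d
split x j with j ℕ.<? x
... | yes lt = inj₁ lt
... | no ge  = inj₂ (j ∸ x , sym (ℕ.m+[n∸m]≡n (ℕ.≮⇒≥ ge)))

rowOf-< : ∀ {x j} cs → j < x → rowOf (x ∷ cs) j ≡ 0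
rowOf-< {x} {j} cs lt with j ℕ.<? x
... | yes _ = refl
... | no ge = contradiction lt ge

rowOf-+ : ∀ x cs j → rowOf (x ∷ cs) (x + j) ≡ suc (rowOf cs j)
rowOf-+ x cs j with (x + j) ℕ.<? x
... | yes lt = contradiction lt (ℕ.m+n≮m x j)
... | no _   = cong (suc ∘ rowOf cs) (ℕ.m+n∸m≡n x j)

rowOf-suc : ∀ x cs j → rowOf (suc x ∷ cs) (suc j) ≡ rowOf (x ∷ cs) j
rowOf-suc x cs j with split x j
... | inj₁ lt         = trans (rowOf-< cs (s<s lt)) (sym (rowOf-< cs lt))
... | inj₂ (d , refl) = trans (rowOf-+ (suc x) cs d) (sym (rowOf-+ x cs d))

rowOf-bound : ∀ c {j} → j < sum c → rowOf c j < length c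
rowOf-bound (x ∷ c) {j} lt with split x j
... | inj₁ j<x        rewrite rowOf-< c j<x = z<s
... | inj₂ (d , refl) rewrite rowOf-+ x c d = s<s (rowOf-bound c (ℕ.+-cancelˡ-< x d (sum c) lt))

rowOf-mono : ∀ c {i j} → i ≤ j → rowOf c i ≤ rowOf c j
rowOf-mono []      le = z≤n
rowOf-mono (x ∷ c) {i} {j} le with split x i | split x j
... | inj₁ i<x        | _               rewrite rowOf-< c i<x = z≤n
... | inj₂ (d , refl) | inj₁ j<x        = contradiction (ℕ.≤-<-trans le j<x) (ℕ.m+n≮m x d)
... | inj₂ (d , refl) | inj₂ (e , refl) rewrite rowOf-+ x c d | rowOf-+ x c e =
  s≤s (rowOf-mono c (ℕ.+-cancelˡ-≤ x d e le))

rowOf-prefix : ∀ c i {j} → sum (List.take i c) ≤ j → j < sum (List.take (suc i) c) → rowOf c j ≡ i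
rowOf-prefix (x ∷ c) zero    le lt = rowOf-< c (subst (_ <_) (ℕ.+-identityʳ x) lt)
rowOf-prefix (x ∷ c) (suc i) {j} le lt with split x j
... | inj₁ j<x        = contradiction (ℕ.≤-<-trans le j<x) (ℕ.m+n≮m x _)
... | inj₂ (d , refl) = trans (rowOf-+ x c d)
  (cong suc (rowOf-prefix c i (ℕ.+-cancelˡ-≤ x _ d le) (ℕ.+-cancelˡ-< x d _ lt)))

partialSums-positive : ∀ {c q} → All (0 <_) c → q ∈ partialSums c → 0 < q
partialSums-positive {x ∷ y ∷ c} (x>0 ∷ _)   (here refl) = x>0
partialSums-positive {x ∷ y ∷ c} (x>0 ∷ y>0) (there q∈) with ∈.∈-map⁻ (x +_) q∈
... | _ , _ , refl = ℕ.<-≤-trans x>0 (ℕ.m≤m+n x _)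

-- Partial sums are 1-indexed and rows are read at 0-indexed positions: `suc p` is a partial sum
-- when position `p` is the last of its row. Positivity of the next entry makes the index rise by
-- exactly one.
rowOf-step∈ : ∀ {c p} → All (0 <_) c → suc p ∈ partialSums c → rowOf c (suc p) ≡ suc (rowOf c p)
rowOf-step∈ {x ∷ y ∷ c} {p} (_ ∷ y>0 ∷ _) (here refl) = begin
  rowOf (suc p ∷ y ∷ c) (suc p)       ≡⟨ cong (rowOf (suc p ∷ y ∷ c)) (ℕ.+-identityʳ (suc p)) ⟨
  rowOf (suc p ∷ y ∷ c) (suc p + 0)   ≡⟨ rowOf-+ (suc p) (y ∷ c) 0 ⟩
  suc (rowOf (y ∷ c) 0)               ≡⟨ cong suc (rowOf-< c y>0) ⟩
  1                                   ≡⟨ cong suc (rowOf-< (y ∷ c) (ℕ.n<1+n p)) ⟨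
  suc (rowOf (suc p ∷ y ∷ c) p)       ∎
  where open ≡-Reasoning
rowOf-step∈ {x ∷ y ∷ c} {p} (_ ∷ pos) (there p∈) with ∈.∈-map⁻ (x +_) p∈
... | zero  , q∈ , _  = contradiction (partialSums-positive pos q∈) (λ ())
... | suc q , q∈ , eq with ℕ.suc-injective (trans eq (ℕ.+-suc x q))
...   | refl = begin
  rowOf (x ∷ y ∷ c) (suc (x + q))     ≡⟨ cong (rowOf (x ∷ y ∷ c)) (ℕ.+-suc x q) ⟨
  rowOf (x ∷ y ∷ c) (x + suc q)       ≡⟨ rowOf-+ x (y ∷ c) (suc q) ⟩
  suc (rowOf (y ∷ c) (suc q))         ≡⟨ cong suc (rowOf-step∈ pos q∈) ⟩
  suc (suc (rowOf (y ∷ c) q))         ≡⟨ cong suc (rowOf-+ x (y ∷ c) q) ⟨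
  suc (rowOf (x ∷ y ∷ c) (x + q))     ∎
  where open ≡-Reasoning

-- The bound on `suc p` excludes the total, where the row index changes although `partialSums` omits
-- it.
rowOf-step∉ : ∀ c {p} → suc p < sum c → suc p ∉ partialSums c → rowOf c (suc p) ≡ rowOf c p
rowOf-step∉ (x ∷ []) {p} lt p∉ = trans (rowOf-< [] p<x) (sym (rowOf-< [] (ℕ.<-trans (ℕ.n<1+n p) p<x)))
  where
  p<x : suc p < x
  p<x = subst (suc p <_) (ℕ.+-identityʳ x) lt
rowOf-step∉ (x ∷ y ∷ c) {p} lt p∉ with split x (suc p) | (λ {q} → rowOf-step∉ (y ∷ c) {q})
... | inj₁ p<x | _ =
  trans (rowOf-< (y ∷ c) p<x) (sym (rowOf-< (y ∷ c) (ℕ.<-trans (ℕ.n<1+n p) p<x)))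
... | inj₂ (zero , eq) | _ = contradiction (here (trans eq (ℕ.+-identityʳ x))) p∉
... | inj₂ (suc q , eq) | rec with ℕ.suc-injective (trans eq (ℕ.+-suc x q))
...   | refl = begin
  rowOf (x ∷ y ∷ c) (suc (x + q))     ≡⟨ cong (rowOf (x ∷ y ∷ c)) (ℕ.+-suc x q) ⟨
  rowOf (x ∷ y ∷ c) (x + suc q)       ≡⟨ rowOf-+ x (y ∷ c) (suc q) ⟩
  suc (rowOf (y ∷ c) (suc q))         ≡⟨ cong suc (rec q< q∉) ⟩
  suc (rowOf (y ∷ c) q)               ≡⟨ rowOf-+ x (y ∷ c) q ⟨
  rowOf (x ∷ y ∷ c) (x + q)           ∎
  where
  open ≡-Reasoning
  q< : suc q < sum (y ∷ c)
  q< = ℕ.+-cancelˡ-< x _ _ (subst (_< x + sum (y ∷ c)) eq lt)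
  q∉ : suc q ∉ partialSums (y ∷ c)
  q∉ q∈ = p∉ (there (subst (_∈ List.map (x +_) (partialSums (y ∷ c))) (ℕ.+-suc x q) (∈.∈-map⁺ (x +_) q∈)))

-- Supplies the two neighbouring positions `p` and `suc p` around the border of rows `i` and
-- `suc i`, whose transposition proves that `g` is a cycle. The last bound holds because row `suc i`
-- is nonempty.
row-end : ∀ {c} → All (0 <_) c → ∀ {i} → suc i < length c →
          ∃ λ p → suc p ∈ partialSums c × rowOf c p ≡ i × suc p < sum c
row-end {x ∷ []} _ (s≤s ())
row-end {suc x ∷ y ∷ c} (_ ∷ y>0 ∷ _) {zero} _ =
  x , here refl , rowOf-< (y ∷ c) (ℕ.n<1+n x) ,
  ℕ.m<m+n (suc x) (ℕ.<-≤-trans y>0 (ℕ.m≤m+n y (sum c)))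
row-end {x ∷ y ∷ c} (_ ∷ pos) {suc i} (s≤s lt) with row-end pos lt
... | p , p∈ , eq , p< =
  x + p , there (subst (_∈ List.map (x +_) (partialSums (y ∷ c))) (ℕ.+-suc x p) (∈.∈-map⁺ (x +_) p∈)) ,
  trans (rowOf-+ x (y ∷ c) p) (cong suc eq) ,
  subst (_< x + sum (y ∷ c)) (ℕ.+-suc x p) (ℕ.+-monoʳ-< x p<)

module _ (c : List ℕ) where
  private
    break? : ∀ j → Dec (j ∉ partialSums c)
    break? j = ¬? (j ∈? partialSums c)

    colOf-suc : ∀ p → colOf c (suc (suc p)) ≡
                      colOf c (suc p) + length (filter break? (suc p ∷ []))
    colOf-suc p = begin
      length (filter break? (List.map suc (List.upTo (suc p))))
        ≡⟨ cong (length ∘ filter break? ∘ List.map suc) (List.upTo-∷ʳ p) ⟨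
      length (filter break? (List.map suc (List.upTo p List.++ p ∷ [])))
        ≡⟨ cong (length ∘ filter break?) (List.map-++ suc (List.upTo p) (p ∷ [])) ⟩
      length (filter break? (List.map suc (List.upTo p) List.++ suc p ∷ []))
        ≡⟨ cong length (List.filter-++ break? (List.map suc (List.upTo p)) (suc p ∷ [])) ⟩
      length (filter break? (List.map suc (List.upTo p)) List.++ filter break? (suc p ∷ []))
        ≡⟨ List.length-++ (filter break? (List.map suc (List.upTo p))) ⟩
      colOf c (suc p) + length (filter break? (suc p ∷ [])) ∎
      where open ≡-Reasoning

  colOf-step∈ : ∀ {p} → suc p ∈ partialSums c → colOf c (suc (suc p)) ≡ colOf c (suc p)
  colOf-step∈ {p} p∈ = trans (colOf-suc p)
    (trans (cong (λ xs → colOf c (suc p) + length xs) (List.filter-reject break? (λ p∉ → p∉ p∈)))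
           (ℕ.+-identityʳ _))

  colOf-step∉ : ∀ {p} → suc p ∉ partialSums c → colOf c (suc (suc p)) ≡ suc (colOf c (suc p))
  colOf-step∉ {p} p∉ = trans (colOf-suc p)
    (trans (cong (λ xs → colOf c (suc p) + length xs) (List.filter-accept break? p∉))
           (ℕ.+-comm _ 1))

  colOf-mono : ∀ {i j} → i ≤ j → colOf c (suc i) ≤ colOf c (suc j)
  colOf-mono {i} {j} le with ℕ.m≤n⇒m<n∨m≡n le
  ... | inj₂ refl = ℕ.≤-refl
  colOf-mono {i} {suc j} le | inj₁ (s≤s i≤j) with suc j ∈? partialSums c
  ... | yes j∈ = subst (_ ≤_) (sym (colOf-step∈ j∈)) (colOf-mono i≤j)
  ... | no j∉  = subst (_ ≤_) (sym (colOf-step∉ j∉)) (ℕ.m≤n⇒m≤1+n (colOf-mono i≤j))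

  -- The column index never decreases and rises at each `suc p` that is not a partial sum, so equal
  -- indices leave no room for a rise at the end.
  column-last-step : ∀ {i p} → i ≤ p → colOf c (suc i) ≡ colOf c (suc (suc p)) →
                     suc p ∈ partialSums c × colOf c (suc i) ≡ colOf c (suc p)
  column-last-step {i} {p} i≤p eq with suc p ∈? partialSums c
  ... | yes p∈ = p∈ , trans eq (colOf-step∈ p∈)
  ... | no p∉  =
    contradiction (subst (_≤ colOf c (suc p)) (trans eq (colOf-step∉ p∉)) (colOf-mono i≤p)) ℕ.1+n≰n

  -- A column is a run of consecutive positions joined only by steps across row ends; a transitive
  -- relation spreads from these steps to the column.
  column-transitive : ∀ {R : ℕ → ℕ → Set} → (∀ {i j k} → R i j → R j k → R i k) →
    (∀ {p} → suc p ∈ partialSums c → R p (suc p)) →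
    ∀ {i j} → i < j → colOf c (suc i) ≡ colOf c (suc j) → R i j
  column-transitive tr step {i} {suc p} (s≤s i≤p) eq with column-last-step i≤p eq | ℕ.m≤n⇒m<n∨m≡n i≤p
  ... | p∈ , eq′ | inj₁ i<p  = tr (column-transitive tr step i<p eq′) (step p∈)
  ... | p∈ , eq′ | inj₂ refl = step p∈

  column-row-< : All (0 <_) c → ∀ {i j} → i < j → colOf c (suc i) ≡ colOf c (suc j) →
                 rowOf c i < rowOf c j
  column-row-< pos = column-transitive ℕ.<-trans (λ p∈ → ℕ.≤-reflexive (sym (rowOf-step∈ pos p∈)))

  -- Row and column serve as coordinates in the ribbon shape of `c`: along a column the row strictly
  -- increases, so the two meet at most once.
  row-column-injective : All (0 <_) c → ∀ {i j} → rowOf c i ≡ rowOf c j →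
                         colOf c (suc i) ≡ colOf c (suc j) → i ≡ j
  row-column-injective pos {i} {j} req ceq with ℕ.<-cmp i j
  ... | tri< lt _ _ = contradiction req (ℕ.<⇒≢ (column-row-< pos lt ceq))
  ... | tri≈ _ eq _ = eq
  ... | tri> _ _ gt = contradiction (sym req) (ℕ.<⇒≢ (column-row-< pos gt (sym ceq)))

  row-increasing : ∀ {w : ℕ → ℕ} {N} →
    (∀ {p} → suc p < N → rowOf c p ≡ rowOf c (suc p) → w p < w (suc p)) →
    ∀ {i j} → i < j → j < N → rowOf c i ≡ rowOf c j → w i < w j
  row-increasing step {i} {suc p} (s≤s i≤p) j<N eq with ℕ.m≤n⇒m<n∨m≡n i≤p
  ... | inj₂ refl = step j<N eq
  ... | inj₁ i<p  = ℕ.<-trans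
    (row-increasing step i<p (ℕ.<-trans (ℕ.n<1+n p) j<N) ri≡rp)
    (step j<N (trans (sym ri≡rp) eq))
    where
    ri≡rp : rowOf c i ≡ rowOf c p
    ri≡rp = ℕ.≤-antisym (rowOf-mono c i≤p)
              (subst (rowOf c p ≤_) (sym eq) (rowOf-mono c (ℕ.n≤1+n p)))

-- The descents of `w` are exactly the row ends of `c`, said pair by pair. Inside a row the
-- inequality is weak because a non-descent gives no more; strictness comes later from injectivity.
RowStandard : List ℕ → List ℕ → Set
RowStandard c w = ∀ p → suc p < length w →
  (rowOf c p ≡ rowOf c (suc p) → nth w p ≤ nth w (suc p)) ×
  (rowOf c p ≢ rowOf c (suc p) → nth w (suc p) < nth w p)

-- The next cut lies at the first descent still to come, at position `suc pos` or later, or at the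
-- end of the word.
gaps-head : ∀ w {a N} prev pos → N ≡ pos + suc (length w) →
  ∃ λ h → ∃ λ t → gaps N prev (descentsFrom (suc pos) (a ∷ w)) ≡ h ∷ t × suc pos ∸ prev ≤ h
gaps-head [] prev pos refl = _ , _ , refl , ℕ.≤-reflexive (cong (_∸ prev) (ℕ.+-comm 1 pos))
gaps-head (b ∷ w) {a} prev pos eq with b ℕ.<? a
... | yes _ = _ , _ , refl , ℕ.≤-refl
... | no _ with gaps-head w {b} prev (suc pos) (trans eq (ℕ.+-suc pos _))
...   | h , t , eq′ , le = h , t , eq′ , ℕ.≤-trans (ℕ.∸-monoˡ-≤ prev (ℕ.n≤1+n (suc pos))) le

-- Induction on the unread word with a state: `pos` letters are read and the last cut is at `prev`,
-- so the current part consists of `pos ∸ prev` letters read and `x` letters left.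
gaps⇒standard : ∀ w {N} prev pos {x cs} → prev ≤ pos → N ≡ pos + length w → All (0 <_) (x ∷ cs) →
  gaps N prev (descentsFrom (suc pos) w) ≡ (pos ∸ prev + x) ∷ cs → RowStandard (x ∷ cs) w
gaps⇒standard []      _ _ _ _ _ _ _ ()
gaps⇒standard (a ∷ []) _ _ _ _ _ _ _ (s≤s ())
gaps⇒standard (a ∷ b ∷ w) {N} prev pos {x} {cs} le eq (x>0 ∷ cs>0) geq
  with b ℕ.<? a
gaps⇒standard (a ∷ b ∷ w) {N} prev pos {x} {cs} le eq (x>0 ∷ cs>0) geq | yes b<a
  -- A descent at `suc pos` closes the part after one more letter, which forces `x` to be 1.
  with ℕ.+-cancelˡ-≡ (pos ∸ prev) 1 x
         (trans (ℕ.+-comm (pos ∸ prev) 1)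
                (trans (sym (ℕ.+-∸-assoc 1 le)) (List.∷-injectiveˡ geq)))
     | gaps-head w {b} {N} (suc pos) (suc pos) (trans eq (ℕ.+-suc pos _))
... | refl | h , t , heq , _ with trans (sym heq) (List.∷-injectiveʳ geq)
...   | refl = λ
  { zero    _       → (λ r → contradiction (trans r (rowOf-+ 1 cs 0)) λ ()) , λ _ → b<a
  ; (suc p) (s≤s q) → let up , down = rest p q in
      (λ r → up (ℕ.suc-injective (trans (sym (rowOf-+ 1 cs p)) (trans r (rowOf-+ 1 cs (suc p)))))) ,
      (λ r → down λ e → r (trans (rowOf-+ 1 cs p) (trans (cong suc e) (sym (rowOf-+ 1 cs (suc p)))))) }
  where
  rest : RowStandard cs (b ∷ w)
  rest = gaps⇒standard (b ∷ w) (suc pos) (suc pos) ℕ.≤-refl (trans eq (ℕ.+-suc pos _)) cs>0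
    (trans heq (cong (λ z → z + h ∷ t) (sym (ℕ.n∸n≡0 pos))))
gaps⇒standard (a ∷ b ∷ w) {N} prev pos {x} {cs} le eq (x>0 ∷ cs>0) geq | no b≮a
  with gaps-head w {b} {N} prev (suc pos) (trans eq (ℕ.+-suc pos _))
... | h , t , heq , h≥ with x | List.∷-injectiveˡ (trans (sym heq) geq) | geq
...   | zero        | _  | _    = contradiction x>0 λ ()
-- With one letter left the part would end at `suc pos`; as there is no descent there, the cut comes
-- at `suc (suc pos)` or later.
...   | suc zero    | h≡ | _    = contradiction
  (subst₂ _≤_ (ℕ.+-∸-assoc 2 le) (trans h≡ (ℕ.+-comm _ 1)) h≥) ℕ.1+n≰n
...   | suc (suc y) | _  | geq′ = λ
  { zero    _       → (λ _ → ℕ.≮⇒≥ b≮a) ,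
                      λ r → contradiction (sym (rowOf-suc (suc y) cs 0)) r
  ; (suc p) (s≤s q) → let up , down = rest p q in
      (λ r → up (trans (sym (rowOf-suc (suc y) cs p)) (trans r (rowOf-suc (suc y) cs (suc p))))) ,
      (λ r → down λ e → r (trans (rowOf-suc (suc y) cs p) (trans e (sym (rowOf-suc (suc y) cs (suc p)))))) }
  where
  rest : RowStandard (suc y ∷ cs) (b ∷ w)
  rest = gaps⇒standard (b ∷ w) prev (suc pos) (ℕ.m≤n⇒m≤1+n le) (trans eq (ℕ.+-suc pos _)) (z<s ∷ cs>0)
    (trans geq′ (cong (_∷ cs) (trans (ℕ.+-suc (pos ∸ prev) (suc y))
      (cong (_+ suc y) (sym (ℕ.+-∸-assoc 1 le))))))

-- Same state as in `gaps⇒standard`. The sum condition makes the letters and the remaining parts run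
-- out together.
standard⇒gaps : ∀ w {N} prev pos {x cs} → prev ≤ pos → N ≡ pos + length w → All (0 <_) (x ∷ cs) →
  sum (x ∷ cs) ≡ length w → RowStandard (x ∷ cs) w →
  gaps N prev (descentsFrom (suc pos) w) ≡ (pos ∸ prev + x) ∷ cs
standard⇒gaps _ _ _ {zero} _ _ (() ∷ _) _ _
standard⇒gaps [] _ _ {suc x} _ _ _ () _
standard⇒gaps (a ∷ []) prev pos {suc zero} {[]} le refl _ _ _ = cong (_∷ []) (ℕ.+-∸-comm 1 le)
standard⇒gaps (a ∷ []) _ _ {suc zero} {zero ∷ cs} _ _ (_ ∷ () ∷ _) _ _
standard⇒gaps (a ∷ []) _ _ {suc zero} {suc y ∷ cs} _ _ _ () _
standard⇒gaps (a ∷ []) _ _ {suc (suc x)} _ _ _ () _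
standard⇒gaps (a ∷ b ∷ w) prev pos {suc x} {cs} le eq (_ ∷ cs>0) s≡ std with b ℕ.<? a
standard⇒gaps (a ∷ b ∷ w) _ _ {suc zero} {zero ∷ cs} _ _ (_ ∷ () ∷ _) _ _ | yes _
standard⇒gaps (a ∷ b ∷ w) prev pos {suc zero} {suc y ∷ cs} le eq (_ ∷ cs>0) s≡ std | yes b<a =
  cong₂ _∷_ (trans (ℕ.+-∸-assoc 1 le) (ℕ.+-comm 1 (pos ∸ prev)))
    (trans (standard⇒gaps (b ∷ w) (suc pos) (suc pos) ℕ.≤-refl (trans eq (ℕ.+-suc pos _)) cs>0
             (ℕ.suc-injective s≡) rest)
           (cong (λ z → z + suc y ∷ cs) (ℕ.n∸n≡0 pos)))
  where
  rest : RowStandard (suc y ∷ cs) (b ∷ w)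
  rest p q = let up , down = std (suc p) (s≤s q) in
    (λ r → up (trans (rowOf-+ 1 _ p) (trans (cong suc r) (sym (rowOf-+ 1 _ (suc p)))))) ,
    (λ r → down λ e → r (ℕ.suc-injective (trans (sym (rowOf-+ 1 _ p)) (trans e (rowOf-+ 1 _ (suc p))))))
standard⇒gaps (a ∷ b ∷ w) prev pos {suc (suc y)} {cs} le eq (_ ∷ cs>0) s≡ std | yes b<a =
  contradiction (proj₁ (std 0 (s≤s (s≤s z≤n))) (sym (rowOf-suc (suc y) cs 0))) (ℕ.<⇒≱ b<a)
standard⇒gaps (a ∷ b ∷ w) prev pos {suc zero} {cs} le eq (_ ∷ cs>0) s≡ std | no b≮a =
  contradiction (proj₂ (std 0 (s≤s (s≤s z≤n))) λ r → contradiction (trans r (rowOf-+ 1 cs 0)) λ ()) b≮a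
standard⇒gaps (a ∷ b ∷ w) prev pos {suc (suc y)} {cs} le eq (_ ∷ cs>0) s≡ std | no b≮a =
  trans (standard⇒gaps (b ∷ w) prev (suc pos) (ℕ.m≤n⇒m≤1+n le) (trans eq (ℕ.+-suc pos _)) (z<s ∷ cs>0)
          (ℕ.suc-injective s≡) rest)
        (cong (_∷ cs) (trans (cong (_+ suc y) (ℕ.+-∸-assoc 1 le)) (sym (ℕ.+-suc (pos ∸ prev) (suc y)))))
  where
  rest : RowStandard (suc y ∷ cs) (b ∷ w)
  rest p q = let up , down = std (suc p) (s≤s q) in
    (λ r → up (trans (rowOf-suc (suc y) cs p) (trans r (sym (rowOf-suc (suc y) cs (suc p)))))) ,
    (λ r → down λ e → r (trans (sym (rowOf-suc (suc y) cs p)) (trans e (rowOf-suc (suc y) cs (suc p)))))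

-- Sizes of rows, and lengths under coarsening

sumBelow : (ℕ → ℕ) → ℕ → ℕ
sumBelow f zero    = 0
sumBelow f (suc n) = f 0 + sumBelow (f ∘ suc) n

module _ where
  open ℕ-Sum

  -- With natural-number bounds the range of positions can be cut after the first row, as `row-size`
  -- does.
  ∑-allFin-toℕ : ∀ f n → ∑ (allFin n) (f ∘ toℕ) ≡ sumBelow f n
  ∑-allFin-toℕ f zero    = refl
  ∑-allFin-toℕ f (suc n) =
    trans (∑-allFin-suc {n} (f ∘ toℕ)) (cong (f 0 +_) (∑-allFin-toℕ (f ∘ suc) n))

  sumBelow-+ : ∀ f x n → sumBelow f (x + n) ≡ sumBelow f x + sumBelow (λ j → f (x + j)) n
  sumBelow-+ f zero    n = refl
  sumBelow-+ f (suc x) n =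
    trans (cong (f 0 +_) (sumBelow-+ (f ∘ suc) x n)) (sym (ℕ.+-assoc (f 0) _ _))

  sumBelow-const : ∀ {f} v n → (∀ {j} → j < n → f j ≡ v) → sumBelow f n ≡ n * v
  sumBelow-const v zero    eq = refl
  sumBelow-const v (suc n) eq = cong₂ _+_ (eq z<s) (sumBelow-const v n (eq ∘ s<s))

  sumBelow-cong : ∀ {f h} n → (∀ j → f j ≡ h j) → sumBelow f n ≡ sumBelow h n
  sumBelow-cong zero    eq = refl
  sumBelow-cong (suc n) eq = cong₂ _+_ (eq 0) (sumBelow-cong n (eq ∘ suc))

  row-size : ∀ c {i} → i < length c → sumBelow (λ j → [ rowOf c j ℕ.≟ i ]) (sum c) ≡ nth c i
  row-size (x ∷ c) {zero} _ = begin
    sumBelow (λ j → [ rowOf (x ∷ c) j ℕ.≟ 0 ]) (x + sum c)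
      ≡⟨ sumBelow-+ _ x (sum c) ⟩
    sumBelow (λ j → [ rowOf (x ∷ c) j ℕ.≟ 0 ]) x +
      sumBelow (λ j → [ rowOf (x ∷ c) (x + j) ℕ.≟ 0 ]) (sum c)
      ≡⟨ cong₂ _+_ (sumBelow-const 1 x λ j<x → []-yes (_ ℕ.≟ _) (rowOf-< c j<x))
                   (sumBelow-const 0 (sum c) λ {j} _ → []-no (_ ℕ.≟ _) λ e →
                      contradiction (trans (sym e) (rowOf-+ x c j)) λ ()) ⟩
    x * 1 + sum c * 0
      ≡⟨ cong₂ _+_ (ℕ.*-identityʳ x) (ℕ.*-zeroʳ (sum c)) ⟩
    x + 0
      ≡⟨ ℕ.+-identityʳ x ⟩
    x ∎
    where open ≡-Reasoning
  row-size (x ∷ c) {suc i} (s≤s lt) = begin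
    sumBelow (λ j → [ rowOf (x ∷ c) j ℕ.≟ suc i ]) (x + sum c)
      ≡⟨ sumBelow-+ _ x (sum c) ⟩
    sumBelow (λ j → [ rowOf (x ∷ c) j ℕ.≟ suc i ]) x +
      sumBelow (λ j → [ rowOf (x ∷ c) (x + j) ℕ.≟ suc i ]) (sum c)
      ≡⟨ cong₂ _+_ (sumBelow-const 0 x λ j<x → []-no (_ ℕ.≟ _) λ e →
                      contradiction (trans (sym (rowOf-< c j<x)) e) λ ())
                   (sumBelow-cong (sum c) λ j → []-⇔ (_ ℕ.≟ _) (_ ℕ.≟ _)
                      (λ e → ℕ.suc-injective (trans (sym (rowOf-+ x c j)) e))
                      (λ e → trans (rowOf-+ x c j) (cong suc e))) ⟩
    x * 0 + sumBelow (λ j → [ rowOf c j ℕ.≟ i ]) (sum c)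
      ≡⟨ cong₂ _+_ (ℕ.*-zeroʳ x) (row-size c lt) ⟩
    nth c i ∎
    where open ≡-Reasoning

partialSums-bound : ∀ {c q} → All (0 <_) c → q ∈ partialSums c → q < sum c
partialSums-bound {x ∷ y ∷ c} (_ ∷ y>0 ∷ _) (here refl) =
  ℕ.m<m+n x (ℕ.<-≤-trans y>0 (ℕ.m≤m+n y (sum c)))
partialSums-bound {x ∷ y ∷ c} (_ ∷ pos)     (there q∈) with ∈.∈-map⁻ (x +_) q∈
... | _ , q∈′ , refl = ℕ.+-monoʳ-< x (partialSums-bound pos q∈′)

nth-positive : ∀ {c i} → All (0 <_) c → i < length c → 0 < nth c i
nth-positive {i = zero}  (x>0 ∷ _) _        = x>0
nth-positive {i = suc i} (_ ∷ pos) (s≤s lt) = nth-positive pos lt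

coarsens-refl : ∀ c → Coarsens c c
coarsens-refl []      = done
coarsens-refl (x ∷ c) = new (coarsens-refl c)

coarsens-length : ∀ {c d} → Coarsens c d → length d ≤ length c
coarsens-length done      = z≤n
coarsens-length (new p)   = s≤s (coarsens-length p)
coarsens-length (merge p) = ℕ.m≤n⇒m≤1+n (coarsens-length p)

-- Each `merge` loses an entry, so lists of equal length admit none.
coarsens-≡ : ∀ {c d} → Coarsens c d → length c ≡ length d → c ≡ d
coarsens-≡ done      _  = refl
coarsens-≡ (new p)   eq = cong (_ ∷_) (coarsens-≡ p (ℕ.suc-injective eq))
coarsens-≡ (merge p) eq =
  contradiction (ℕ.≤-trans (ℕ.≤-reflexive eq) (coarsens-length p)) ℕ.1+n≰n

tabulate-≡⇒nth : ∀ c {f : Fin (length c) → ℕ} → List.tabulate f ≡ c → ∀ i → f i ≡ nth c (toℕ i)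
tabulate-≡⇒nth (x ∷ c) eq zero    = List.∷-injectiveˡ eq
tabulate-≡⇒nth (x ∷ c) eq (suc i) = tabulate-≡⇒nth c (List.∷-injectiveʳ eq) i

nth⇒tabulate-≡ : ∀ c {f : Fin (length c) → ℕ} → (∀ i → f i ≡ nth c (toℕ i)) → List.tabulate f ≡ c
nth⇒tabulate-≡ []      eq = refl
nth⇒tabulate-≡ (x ∷ c) eq = cong₂ _∷_ (eq zero) (nth⇒tabulate-≡ c (eq ∘ suc))

-- Faces, tabloids and their order

toℕ-pinch-≤ : ∀ {r} (i : Fin r) x → toℕ x ≤ toℕ i → toℕ (pinch i x) ≡ toℕ x
toℕ-pinch-≤ zero    zero    _        = refl
toℕ-pinch-≤ (suc i) zero    _        = refl
toℕ-pinch-≤ (suc i) (suc x) (s≤s le) = cong suc (toℕ-pinch-≤ i x le)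

toℕ-pinch-> : ∀ {r} (i : Fin r) x → toℕ i < toℕ x → suc (toℕ (pinch i x)) ≡ toℕ x
toℕ-pinch-> zero    (suc x) _        = refl
toℕ-pinch-> (suc i) (suc x) (s≤s lt) = cong suc (toℕ-pinch-> i x lt)

pinch-adjacent : ∀ {r} (i : Fin r) x y → toℕ x ≡ toℕ i → toℕ y ≡ suc (toℕ i) → pinch i x ≡ pinch i y
pinch-adjacent i x y ex ey = Fin.toℕ-injective (trans (trans (toℕ-pinch-≤ i x (ℕ.≤-reflexive ex)) ex)
  (ℕ.suc-injective (trans (sym ey) (sym (toℕ-pinch-> i y (ℕ.≤-reflexive (sym ey)))))))

pinch-collision : ∀ {r} (i : Fin r) x y → pinch i x ≡ pinch i y → toℕ x < toℕ y →
                  toℕ x ≡ toℕ i × toℕ y ≡ suc (toℕ i)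
pinch-collision i x y eq lt with toℕ x ℕ.≤? toℕ i | toℕ y ℕ.≤? toℕ i
... | yes x≤i | yes y≤i = contradiction
  (trans (sym (toℕ-pinch-≤ i x x≤i)) (trans (cong toℕ eq) (toℕ-pinch-≤ i y y≤i))) (ℕ.<⇒≢ lt)
... | no x≰i  | yes y≤i = contradiction (ℕ.≤-trans (ℕ.<⇒≤ lt) y≤i) x≰i
... | no x≰i  | no y≰i  = contradiction
  (trans (sym (toℕ-pinch-> i x (ℕ.≰⇒> x≰i)))
         (trans (cong (suc ∘ toℕ) eq) (toℕ-pinch-> i y (ℕ.≰⇒> y≰i)))) (ℕ.<⇒≢ lt)
... | yes x≤i | no y≰i  = x≡i , trans y≡ (cong suc x≡i)
  where
  y≡ : toℕ y ≡ suc (toℕ x)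
  y≡ = trans (sym (toℕ-pinch-> i y (ℕ.≰⇒> y≰i)))
             (cong suc (trans (cong toℕ (sym eq)) (toℕ-pinch-≤ i x x≤i)))
  x≡i : toℕ x ≡ toℕ i
  x≡i = ℕ.≤-antisym x≤i (ℕ.≤-pred (subst (toℕ i <_) y≡ (ℕ.≰⇒> y≰i)))

-- u ≺ v: at the largest element lying in different blocks, the block of u comes first.
_≺_ : ∀ {n k} → Vec (Fin k) n → Vec (Fin k) n → Set
u ≺ v = ∃ λ m → toℕ (lookup u m) < toℕ (lookup v m) ×
                (∀ m′ → toℕ m < toℕ m′ → lookup u m′ ≡ lookup v m′)

last-difference : ∀ {n k} {u v : Vec (Fin k) n} → u ≢ v →
  ∃ λ m → lookup u m ≢ lookup v m × (∀ m′ → toℕ m < toℕ m′ → lookup u m′ ≡ lookup v m′)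
last-difference {u = []}    {[]}    ne = contradiction refl ne
last-difference {u = x ∷ u} {y ∷ v} ne with Vec.≡-dec Fin._≟_ u v
... | yes refl = zero , (λ { refl → ne refl }) , λ { (suc m′) _ → refl }
... | no u≢v with last-difference u≢v
...   | m , m≢ , after = suc m , m≢ , λ { (suc m′) (s≤s lt) → after m′ lt }

-- The blocks as digits of a numeral in base `k`, element 0 being the least significant. It turns
-- `≺` into `<` on natural numbers, the measure for every induction on faces.
value : ∀ {n k} → Vec (Fin k) n → ℕ
value         []      = 0
value {k = k} (x ∷ v) = toℕ x + k * value v

≺⇒value-< : ∀ {n k} (u v : Vec (Fin k) n) → u ≺ v → value u < value v
≺⇒value-< {k = k} (x ∷ u) (y ∷ v) (zero , lt , after)
  rewrite vec-ext {u = u} {v} (λ i → after (suc i) z<s) = ℕ.+-monoˡ-< (k * value v) lt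
≺⇒value-< {k = k} (x ∷ u) (y ∷ v) (suc m , lt , after) = begin-strict
  toℕ x + k * value u   <⟨ ℕ.+-monoˡ-< (k * value u) (Fin.toℕ<n x) ⟩
  k + k * value u       ≡⟨ ℕ.*-suc k (value u) ⟨
  k * suc (value u)     ≤⟨ ℕ.*-monoʳ-≤ k (≺⇒value-< u v (m , lt , λ m′ → after (suc m′) ∘ s<s)) ⟩
  k * value v           ≤⟨ ℕ.m≤n+m _ (toℕ y) ⟩
  toℕ y + k * value v   ∎
  where open ℕ.≤-Reasoning

word : ∀ {n} → Vec (Fin n) n → List ℕ
word α = Vec.toList (Vec.map toℕ α)

length-toList : ∀ {A : Set} {n} (v : Vec A n) → length (Vec.toList v) ≡ n
length-toList []      = refl
length-toList (x ∷ v) = cong suc (length-toList v)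

nth-toList : ∀ {n p} (v : Vec (Fin p) n) j → nth (Vec.toList (Vec.map toℕ v)) (toℕ j) ≡ toℕ (lookup v j)
nth-toList (x ∷ v) zero    = refl
nth-toList (x ∷ v) (suc j) = nth-toList v j

-- With the composition given as `x₀ ∷ cs`, its length computes to a successor: `∂↓` reduces to `∂`,
-- and merges are indexed by `Fin (length cs)`.
module Tabloids {n x₀ : ℕ} {cs : List ℕ} (c>0 : All (0 <_) (x₀ ∷ cs)) (sum≡n : sum (x₀ ∷ cs) ≡ n) where
  open ℕ-Sum

  c : List ℕ
  c = x₀ ∷ cs

  -- The block index is a natural number, so that sizes can be compared before and after a merge,
  -- when the number of blocks differs.
  occurrences : ∀ {r} → OSP n r → ℕ → ℕ
  occurrences a i = ∑ (allFin n) (λ m → [ toℕ (lookup a m) ℕ.≟ i ])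

  HasType : ∀ {r} → OSP n r → Set
  HasType a = ∀ {i} → i < length c → occurrences a i ≡ nth c i

  blockSize-occurrences : ∀ {r} (a : OSP n r) i → blockSize a i ≡ occurrences a (toℕ i)
  blockSize-occurrences a i = trans (count-∑ (Fin._≟ i) a)
    (∑-cong (allFin n) λ m _ → []-⇔ (_ Fin.≟ i) (_ ℕ.≟ _) (cong toℕ) Fin.toℕ-injective)

  typeOf-tabulate : ∀ {r} (a : OSP n r) → typeOf a ≡ List.tabulate (blockSize a)
  typeOf-tabulate a = List.map-tabulate id (blockSize a)

  length-typeOf : ∀ {r} (a : OSP n r) → length (typeOf a) ≡ r
  length-typeOf {r} a = trans (List.length-map (blockSize a) (allFin r)) (List.length-tabulate id)

  typeOf⇒HasType : (a : OSP n (length c)) → typeOf a ≡ c → HasType a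
  typeOf⇒HasType a eq {i} lt = begin
    occurrences a i                            ≡⟨ cong (occurrences a) (Fin.toℕ-fromℕ< lt) ⟨
    occurrences a (toℕ (Fin.fromℕ< lt))        ≡⟨ blockSize-occurrences a _ ⟨
    blockSize a (Fin.fromℕ< lt)                ≡⟨ tabulate-≡⇒nth c {blockSize a}
                                                    (trans (sym (typeOf-tabulate a)) eq) (Fin.fromℕ< lt) ⟩
    nth c (toℕ (Fin.fromℕ< lt))                ≡⟨ cong (nth c) (Fin.toℕ-fromℕ< lt) ⟩
    nth c i                                    ∎
    where open ≡-Reasoning

  HasType⇒typeOf : (a : OSP n (length c)) → HasType a → typeOf a ≡ c
  HasType⇒typeOf a ty = trans (typeOf-tabulate a)
    (nth⇒tabulate-≡ c λ i → trans (blockSize-occurrences a i) (ty (Fin.toℕ<n i)))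

  InΔ⇒HasType : (a : OSP n (length c)) → InΔ c a → HasType a
  InΔ⇒HasType a (_ , co) = typeOf⇒HasType a (sym (coarsens-≡ co (sym (length-typeOf a))))

  HasType⇒InΔ : (a : OSP n (length c)) → HasType a → InΔ c a
  HasType⇒InΔ a ty =
    (λ i _ → subst (0 <_) (sym (trans (blockSize-occurrences a i) (ty (Fin.toℕ<n i))))
                          (nth-positive c>0 (Fin.toℕ<n i))) ,
    subst (Coarsens c) (sym (HasType⇒typeOf a ty)) (coarsens-refl c)

  inΔ? : (a : OSP n (length c)) → Dec (InΔ c a)
  inΔ? a with List.≡-dec ℕ._≟_ (typeOf a) c
  ... | yes eq = yes (HasType⇒InΔ a (typeOf⇒HasType a eq))
  ... | no ne  = no (ne ∘ HasType⇒typeOf a ∘ InΔ⇒HasType a)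

  no-higher-faces : (a : OSP n (suc (length c))) → ¬ InΔ c a
  no-higher-faces a (_ , co) = ℕ.1+n≰n (subst (_≤ length c) (length-typeOf a) (coarsens-length co))

  row : Fin n → ℕ
  row j = rowOf c (toℕ j)

  row-< : ∀ j → row j < length c
  row-< j = rowOf-bound c (subst (toℕ j <_) (sym sum≡n) (Fin.toℕ<n j))

  col : Fin n → ℕ
  col j = colOf c (suc (toℕ j))

  -- The face that the relation `IsSigma` singles out. Off permutations `position` returns junk,
  -- hence the `IsPerm` conditions in the lemmas about its blocks.
  σ : Vec (Fin n) n → OSP n (length c)
  σ β = tabulate (λ m → Fin.fromℕ< (row-< (position β m)))

  σ-isSigma : ∀ β → IsPerm β → IsSigma β c (σ β)
  σ-isSigma β perm j = begin
    toℕ (lookup (σ β) (lookup β j))                              ≡⟨ cong toℕ (Vec.lookup∘tabulate _ (lookup β j)) ⟩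
    toℕ (Fin.fromℕ< (row-< (position β (lookup β j))))           ≡⟨ Fin.toℕ-fromℕ< _ ⟩
    row (position β (lookup β j))                                ≡⟨ cong row (position-lookup β perm j) ⟩
    row j                                                        ∎
    where open ≡-Reasoning

  isSigma-unique : ∀ β → IsPerm β → ∀ {r} (b b′ : OSP n r) → IsSigma β c b → IsSigma β c b′ → b ≡ b′
  isSigma-unique β perm b b′ s s′ = vec-ext λ m →
    subst (λ m → lookup b m ≡ lookup b′ m) (lookup-position β perm m)
          (Fin.toℕ-injective (trans (s (position β m)) (sym (s′ (position β m)))))

  isSigma⇒HasType : ∀ β → IsPerm β → (b : OSP n (length c)) → IsSigma β c b → HasType b
  isSigma⇒HasType β perm b s {i} lt = begin
    ∑ (allFin n) (λ m → [ toℕ (lookup b m) ℕ.≟ i ])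
      ≡⟨ ∑-bijection Fin._≟_ (Unique.allFin⁺ n) (Unique.allFin⁺ n) (lookup β) (position β)
           (λ _ _ → ∈.∈-allFin _) (λ _ _ → ∈.∈-allFin _) (position-lookup β perm)
           (λ m _ → lookup-position β perm m) (λ m → [ toℕ (lookup b m) ℕ.≟ i ]) ⟨
    ∑ (allFin n) (λ j → [ toℕ (lookup b (lookup β j)) ℕ.≟ i ])
      ≡⟨ ∑-cong (allFin n) (λ j _ → cong (λ z → [ z ℕ.≟ i ]) (s j)) ⟩
    ∑ (allFin n) (λ j → [ row j ℕ.≟ i ])
      ≡⟨ ∑-allFin-toℕ (λ j → [ rowOf c j ℕ.≟ i ]) n ⟩
    sumBelow (λ j → [ rowOf c j ℕ.≟ i ]) n
      ≡⟨ cong (sumBelow _) sum≡n ⟨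
    sumBelow (λ j → [ rowOf c j ℕ.≟ i ]) (sum c)
      ≡⟨ row-size c lt ⟩
    nth c i ∎
    where open ≡-Reasoning

  -- Permutations with descent composition `c` and their leading faces

  Standard : Vec (Fin n) n → Set
  Standard α = α ∈ withDescentComposition n c

  standard⇒perm : ∀ {α} → Standard α → IsPerm α
  standard⇒perm std = proj₂ (∈.∈-filter⁻ isPerm? {xs = allOSP n n} (proj₁ (∈.∈-filter⁻ _ {xs = allPerms n} std)))

  length-word : (α : Vec (Fin n) n) → length (word α) ≡ n
  length-word α = length-toList (Vec.map toℕ α)

  standard⇒RowStandard : ∀ {α} → Standard α → RowStandard c (word α)
  standard⇒RowStandard {α} std = gaps⇒standard (word α) 0 0 z≤n (sym (length-word α)) c>0
    (proj₂ (∈.∈-filter⁻ _ {xs = allPerms n} std))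

  RowStandard⇒standard : ∀ {α} → IsPerm α → RowStandard c (word α) → Standard α
  RowStandard⇒standard {α} perm rs = ∈.∈-filter⁺ _ (∈.∈-filter⁺ isPerm? (allOSP-∈ α) perm)
    (standard⇒gaps (word α) 0 0 z≤n (sym (length-word α)) c>0 (trans sum≡n (sym (length-word α))) rs)

  module _ {α : Vec (Fin n) n} (std : Standard α) where
    private
      perm : IsPerm α
      perm = standard⇒perm std

      w : ℕ → ℕ
      w = nth (word α)

      w-injective : ∀ {i j} → i < n → j < n → w i ≡ w j → i ≡ j
      w-injective i<n j<n eq = begin
        _                       ≡⟨ Fin.toℕ-fromℕ< i<n ⟨
        toℕ (Fin.fromℕ< i<n)    ≡⟨ cong toℕ (perm _ _ (Fin.toℕ-injective lookup≡)) ⟩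
        toℕ (Fin.fromℕ< j<n)    ≡⟨ Fin.toℕ-fromℕ< j<n ⟩
        _                       ∎
        where
        open ≡-Reasoning
        w-lookup : ∀ {i} (i<n : i < n) → toℕ (lookup α (Fin.fromℕ< i<n)) ≡ w i
        w-lookup i<n = trans (sym (nth-toList α _)) (cong w (Fin.toℕ-fromℕ< i<n))
        lookup≡ : toℕ (lookup α (Fin.fromℕ< i<n)) ≡ toℕ (lookup α (Fin.fromℕ< j<n))
        lookup≡ = trans (w-lookup i<n) (trans eq (sym (w-lookup j<n)))

      <n⇒<length : ∀ {p} → p < n → p < length (word α)
      <n⇒<length = subst (_ <_) (sym (length-word α))

    standard-rows : ∀ {i j} → toℕ i < toℕ j → row i ≡ row j → toℕ (lookup α i) < toℕ (lookup α j)
    standard-rows {i} {j} i<j eq = subst₂ _<_ (nth-toList α i) (nth-toList α j)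
      (row-increasing c step i<j (Fin.toℕ<n j) eq)
      where
      step : ∀ {p} → suc p < n → rowOf c p ≡ rowOf c (suc p) → w p < w (suc p)
      step {p} p<n eq = ℕ.≤∧≢⇒< (proj₁ (standard⇒RowStandard std p (<n⇒<length p<n)) eq)
        λ w≡ → ℕ.1+n≢n (sym (w-injective (ℕ.<-trans (ℕ.n<1+n p) p<n) p<n w≡))

    -- Every step inside a column crosses a row end, where a standard word descends.
    standard-columns : ∀ {i j} → toℕ i < toℕ j → col i ≡ col j → toℕ (lookup α j) < toℕ (lookup α i)
    standard-columns {i} {j} i<j eq = subst₂ _<_ (nth-toList α j) (nth-toList α i)
      (column-transitive c {λ i j → w j < w i} (λ p q → ℕ.<-trans q p) step i<j eq)
      where
      step : ∀ {p} → suc p ∈ partialSums c → w (suc p) < w p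
      step {p} p∈ = proj₂ (standard⇒RowStandard std p
          (<n⇒<length (subst (suc p <_) sum≡n (partialSums-bound c>0 p∈))))
        λ e → ℕ.1+n≢n (sym (trans e (rowOf-step∈ c>0 p∈)))

  -- Both words list each block of `b` in increasing order. By strong induction on `j`: the value
  -- `α j` stands in `α′` in the same row, and not before `j`, where the words agree, so `α′ j` is
  -- at most `α j`; then exchange the roles.
  standard-unique : ∀ {α α′} → Standard α → Standard α′ → (b : OSP n (length c)) →
                    IsSigma α c b → IsSigma α′ c b → α ≡ α′
  standard-unique {α} {α′} std std′ b s s′ = vec-ext λ j → agree (suc (toℕ j)) j ℕ.≤-refl
    where
    one-way : ∀ {α α′} → Standard α → Standard α′ → IsSigma α c b → IsSigma α′ c b → ∀ j →
      (∀ i → toℕ i < toℕ j → lookup α i ≡ lookup α′ i) → toℕ (lookup α′ j) ≤ toℕ (lookup α j)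
    one-way {α} {α′} std std′ s s′ j before = go (position α′ (lookup α j)) (lookup-position α′ (standard⇒perm std′) _)
      where
      go : ∀ l → lookup α′ l ≡ lookup α j → toℕ (lookup α′ j) ≤ toℕ (lookup α j)
      go l eq with ℕ.<-cmp (toℕ l) (toℕ j)
      ... | tri< l<j _ _ = contradiction
        (cong toℕ (standard⇒perm std _ _ (trans (before l l<j) eq))) (ℕ.<⇒≢ l<j)
      ... | tri≈ _ l≡j _ rewrite Fin.toℕ-injective l≡j = ℕ.≤-reflexive (cong toℕ eq)
      ... | tri> _ _ j<l = subst (λ z → toℕ (lookup α′ j) ≤ toℕ z) eq
        (ℕ.<⇒≤ (standard-rows std′ j<l
          (trans (sym (s j)) (trans (cong (toℕ ∘ lookup b) (sym eq)) (s′ l)))))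
    agree : ∀ N j → toℕ j < N → lookup α j ≡ lookup α′ j
    agree (suc N) j (s≤s j≤N) = Fin.toℕ-injective (ℕ.≤-antisym
      (one-way std′ std s′ s j (λ i i<j → sym (agree N i (ℕ.<-≤-trans i<j j≤N))))
      (one-way std std′ s s′ j (λ i i<j → agree N i (ℕ.<-≤-trans i<j j≤N))))

  module _ {α : Vec (Fin n) n} (std : Standard α) (γ : Vec (Fin n) n) (γ-perm : IsPerm γ) (young : InYoung c γ) where
    private
      α-perm : IsPerm α
      α-perm = standard⇒perm std

    -- Row and column stabilizers meet trivially: `γ` keeps the column of `j` because it lies in the
    -- Young subgroup, and its row because the face is unchanged.
    σ-stabilizer : IsSigma (α ∘ₚ γ) c (σ α) → γ ≡ Vec.allFin n
    σ-stabilizer s = vec-ext λ j → trans (Fin.toℕ-injective (row-column-injective c c>0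
        (trans (sym (trans (cong (toℕ ∘ lookup (σ α)) (lookup-∘ₚ α γ j))
                           (σ-isSigma α α-perm (lookup γ j)))) (s j))
        (young j)))
      (sym (Vec.lookup-allFin j))

    -- At the largest m in different blocks, the row of m under γ cannot be smaller than under the
    -- identity: the entry of the column of m in that row is larger than m, so it still occupies it.
    σ-minimal : ∀ b → IsSigma (α ∘ₚ γ) c b → b ≢ σ α → σ α ≺ b
    σ-minimal b s b≢σ with last-difference b≢σ
    ... | m , bm≢ , after = m , ℕ.≤∧≢⇒< (ℕ.≮⇒≥ not-before) (λ e → bm≢ (Fin.toℕ-injective (sym e))) ,
                            λ m′ lt → sym (after m′ lt)
      where
      s′ : ∀ j → toℕ (lookup b (lookup α (lookup γ j))) ≡ row j
      s′ j = trans (cong (toℕ ∘ lookup b) (sym (lookup-∘ₚ α γ j))) (s j)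
      j₁ j₀ : Fin n
      j₁ = position α m
      j₀ = position γ j₁
      αj₁ : lookup α j₁ ≡ m
      αj₁ = lookup-position α α-perm m
      γj₀ : lookup γ j₀ ≡ j₁
      γj₀ = lookup-position γ γ-perm j₁
      bm : toℕ (lookup b m) ≡ row j₀
      bm = trans (cong (toℕ ∘ lookup b) (sym (trans (cong (lookup α) γj₀) αj₁))) (s′ j₀)
      σm : toℕ (lookup (σ α) m) ≡ row j₁
      σm = trans (cong (toℕ ∘ lookup (σ α)) (sym αj₁)) (σ-isSigma α α-perm j₁)
      col≡ : col j₀ ≡ col j₁
      col≡ = trans (sym (young j₀)) (cong col γj₀)
      not-before : ¬ (toℕ (lookup b m) < toℕ (lookup (σ α) m))
      not-before lt = contradiction (cong toℕ (trans (sym γj₀) (trans (sym (cong (lookup γ) l≡)) γl))) (ℕ.<⇒≢ j₀<j₁ ∘ sym)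
        where
        row< : row j₀ < row j₁
        row< = subst₂ _<_ bm σm lt
        j₀<j₁ : toℕ j₀ < toℕ j₁
        j₀<j₁ = ℕ.≰⇒> λ le → contradiction (rowOf-mono c le) (ℕ.<⇒≱ row<)
        larger : toℕ m < toℕ (lookup α j₀)
        larger = subst (λ z → toℕ z < toℕ (lookup α j₀)) αj₁ (standard-columns std j₀<j₁ col≡)
        l : Fin n
        l = position γ j₀
        γl : lookup γ l ≡ j₀
        γl = lookup-position γ γ-perm j₀
        row-l : row l ≡ row j₀
        row-l = begin
          row l                                      ≡⟨ s′ l ⟨
          toℕ (lookup b (lookup α (lookup γ l)))     ≡⟨ cong (toℕ ∘ lookup b ∘ lookup α) γl ⟩
          toℕ (lookup b (lookup α j₀))               ≡⟨ cong toℕ (after _ larger) ⟩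
          toℕ (lookup (σ α) (lookup α j₀))           ≡⟨ σ-isSigma α α-perm j₀ ⟩
          row j₀                                     ∎
          where open ≡-Reasoning
        l≡ : l ≡ j₀
        l≡ = Fin.toℕ-injective (row-column-injective c c>0 row-l
               (trans (sym (young l)) (cong col γl)))

  -- Merging neighbouring blocks

  occurrences-pinch : ∀ {r} (a : OSP n (suc r)) (i : Fin r) →
    occurrences (Vec.map (pinch i) a) (toℕ i) ≡ occurrences a (toℕ i) + occurrences a (suc (toℕ i))
  occurrences-pinch a i = trans (∑-cong (allFin n) λ m _ → pointwise m) (∑-∙ (allFin n) _ _)
    where
    pointwise : ∀ m → [ toℕ (lookup (Vec.map (pinch i) a) m) ℕ.≟ toℕ i ] ≡
                      [ toℕ (lookup a m) ℕ.≟ toℕ i ] + [ toℕ (lookup a m) ℕ.≟ suc (toℕ i) ]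
    pointwise m rewrite Vec.lookup-map m (pinch i) a with ℕ.<-cmp (toℕ (lookup a m)) (toℕ i)
    ... | tri< lt ne _ rewrite toℕ-pinch-≤ i (lookup a m) (ℕ.<⇒≤ lt)
        | []-no (toℕ (lookup a m) ℕ.≟ toℕ i) ne
        | []-no (toℕ (lookup a m) ℕ.≟ suc (toℕ i)) (ℕ.<⇒≢ (ℕ.m≤n⇒m≤1+n lt)) = refl
    ... | tri≈ _ eq _ rewrite toℕ-pinch-≤ i (lookup a m) (ℕ.≤-reflexive eq)
        | []-yes (toℕ (lookup a m) ℕ.≟ toℕ i) eq
        | []-no (toℕ (lookup a m) ℕ.≟ suc (toℕ i)) (λ e → ℕ.1+n≢n (trans (sym e) eq)) = refl
    ... | tri> _ ne gt rewrite []-no (toℕ (lookup a m) ℕ.≟ toℕ i) ne =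
      []-⇔ (_ ℕ.≟ _) (_ ℕ.≟ _)
        (λ e → trans (sym (toℕ-pinch-> i (lookup a m) gt)) (cong suc e))
        (λ e → ℕ.suc-injective (trans (toℕ-pinch-> i (lookup a m) gt) e))

  occurrences-pinch-below : ∀ {r} (a : OSP n (suc r)) (i : Fin r) {x} → x < toℕ i →
    occurrences (Vec.map (pinch i) a) x ≡ occurrences a x
  occurrences-pinch-below a i {x} x<i = ∑-cong (allFin n) λ m _ → pointwise m
    where
    pointwise : ∀ m → [ toℕ (lookup (Vec.map (pinch i) a) m) ℕ.≟ x ] ≡ [ toℕ (lookup a m) ℕ.≟ x ]
    pointwise m rewrite Vec.lookup-map m (pinch i) a with toℕ (lookup a m) ℕ.≤? toℕ i
    ... | yes le rewrite toℕ-pinch-≤ i (lookup a m) le = refl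
    ... | no ¬le = trans
      ([]-no (_ ℕ.≟ _) λ e → contradiction (toℕ-pinch-> i (lookup a m) gt)
        (ℕ.<⇒≢ (ℕ.≤-<-trans (subst (λ z → suc z ≤ toℕ i) (sym e) x<i) gt)))
      (sym ([]-no (_ ℕ.≟ _) (≢-sym (ℕ.<⇒≢ (ℕ.<-trans x<i gt)))))
      where
      gt : toℕ i < toℕ (lookup a m)
      gt = ℕ.≰⇒> ¬le

  -- If `i` came before `j`, block `i` of the common merged face would have size cᵢ + cᵢ₊₁ when
  -- computed from `a` and cᵢ when computed from `a′`, so cᵢ₊₁ would be zero.
  merged-index-≮ : (a a′ : OSP n (length c)) → HasType a → HasType a′ → ∀ {i j} →
    Vec.map (pinch i) a ≡ Vec.map (pinch j) a′ → ¬ (toℕ i < toℕ j)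
  merged-index-≮ a a′ ty ty′ {i} {j} eq i<j = ℕ.<⇒≢ (nth-positive c>0 i+1<k)
    (ℕ.+-cancelˡ-≡ (nth c (toℕ i)) 0 (nth c (suc (toℕ i))) sizes)
    where
    i+1<k : suc (toℕ i) < length c
    i+1<k = s<s (Fin.toℕ<n i)
    i<k : toℕ i < length c
    i<k = ℕ.<-trans (ℕ.n<1+n _) i+1<k
    sizes : nth c (toℕ i) + 0 ≡ nth c (toℕ i) + nth c (suc (toℕ i))
    sizes = begin
      nth c (toℕ i) + 0                                     ≡⟨ ℕ.+-identityʳ _ ⟩
      nth c (toℕ i)                                         ≡⟨ ty′ i<k ⟨
      occurrences a′ (toℕ i)                                ≡⟨ occurrences-pinch-below a′ j i<j ⟨
      occurrences (Vec.map (pinch j) a′) (toℕ i)            ≡⟨ cong (λ b → occurrences b (toℕ i)) eq ⟨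
      occurrences (Vec.map (pinch i) a) (toℕ i)             ≡⟨ occurrences-pinch a i ⟩
      occurrences a (toℕ i) + occurrences a (suc (toℕ i))   ≡⟨ cong₂ _+_ (ty i<k) (ty i+1<k) ⟩
      nth c (toℕ i) + nth c (suc (toℕ i))                   ∎
      where open ≡-Reasoning

  merged-index-unique : (a a′ : OSP n (length c)) → HasType a → HasType a′ → ∀ {i j} →
    Vec.map (pinch i) a ≡ Vec.map (pinch j) a′ → i ≡ j
  merged-index-unique a a′ ty ty′ {i} {j} eq with ℕ.<-cmp (toℕ i) (toℕ j)
  ... | tri< lt _ _ = contradiction lt (merged-index-≮ a a′ ty ty′ eq)
  ... | tri≈ _ e _  = Fin.toℕ-injective e
  ... | tri> _ _ gt = contradiction gt (merged-index-≮ a′ a ty′ ty (sym eq))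

  AscentAt : OSP n (length c) → Fin (length cs) → Set
  AscentAt b i = ∀ m m′ → toℕ (lookup b m) ≡ toℕ i → toℕ (lookup b m′) ≡ suc (toℕ i) → toℕ m < toℕ m′

  -- Let `m` be the largest element on which the faces differ, and suppose that `b` has it in the
  -- earlier block. By the ascent, block `suc i` of `b` lies above `m`, where the faces agree, so
  -- block `suc i` of `a` contains it and `m` besides. This contradicts the equal sizes.
  resplit-≺ : (a b : OSP n (length c)) → HasType a → HasType b → ∀ {i} → AscentAt b i →
    Vec.map (pinch i) a ≡ Vec.map (pinch i) b → a ≢ b → a ≺ b
  resplit-≺ a b ta tb {i} ascent eq a≢b with last-difference a≢b
  ... | m , am≢ , after with ℕ.<-cmp (toℕ (lookup a m)) (toℕ (lookup b m))
  ...   | tri< lt _ _ = m , lt , after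
  ...   | tri≈ _ e _  = contradiction (Fin.toℕ-injective e) am≢
  ...   | tri> _ _ gt = contradiction (trans (tb i+1<k) (sym (ta i+1<k))) (ℕ.<⇒≢ more)
    where
    i+1<k : suc (toℕ i) < length c
    i+1<k = s<s (Fin.toℕ<n i)
    collision : toℕ (lookup b m) ≡ toℕ i × toℕ (lookup a m) ≡ suc (toℕ i)
    collision = pinch-collision i (lookup b m) (lookup a m)
      (trans (sym (Vec.lookup-map m (pinch i) b))
             (trans (cong (λ v → lookup v m) (sym eq)) (Vec.lookup-map m (pinch i) a))) gt
    more : occurrences b (suc (toℕ i)) < occurrences a (suc (toℕ i))
    more = ∑-mono-< (allFin n)
      (λ m′ → []-mono (_ ℕ.≟ _) (_ ℕ.≟ _) λ e →
         trans (cong toℕ (after m′ (ascent m m′ (proj₁ collision) e))) e)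
      (∈.∈-allFin m)
      (subst₂ _<_ (sym ([]-no (_ ℕ.≟ _) λ e → ℕ.1+n≢n (trans (sym e) (proj₁ collision))))
                  (sym ([]-yes (_ ℕ.≟ _) (proj₂ collision))) z<s)

  -- The row word of b lists the elements in the order of (block, element); `key` encodes that
  -- order and `rank` is the position in the word.
  module RowWord (b : OSP n (length c)) (ty : HasType b) where
    block : Fin n → ℕ
    block m = toℕ (lookup b m)

    key : Fin n → ℕ
    key m = block m * n + toℕ m

    key-< : ∀ {m m′} → block m < block m′ → key m < key m′
    key-< {m} {m′} lt = begin-strict
      block m * n + toℕ m     <⟨ ℕ.+-monoʳ-< (block m * n) (Fin.toℕ<n m) ⟩
      block m * n + n         ≡⟨ ℕ.+-comm (block m * n) n ⟩
      suc (block m) * n       ≤⟨ ℕ.*-monoˡ-≤ n lt ⟩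
      block m′ * n            ≤⟨ ℕ.m≤m+n _ (toℕ m′) ⟩
      block m′ * n + toℕ m′   ∎
      where open ℕ.≤-Reasoning

    key-block : ∀ {m m′} → key m ≤ key m′ → block m ≤ block m′
    key-block le = ℕ.≮⇒≥ λ lt → contradiction le (ℕ.<⇒≱ (key-< lt))

    key-injective : ∀ {m m′} → key m ≡ key m′ → m ≡ m′
    key-injective {m} {m′} eq = Fin.toℕ-injective (ℕ.+-cancelˡ-≡ (block m * n) _ _
      (trans eq (cong (λ z → z * n + toℕ m′) (sym same))))
      where
      same : block m ≡ block m′
      same = ℕ.≤-antisym (key-block (ℕ.≤-reflexive eq)) (key-block (ℕ.≤-reflexive (sym eq)))

    rank : Fin n → ℕ
    rank m = ∑ (allFin n) (λ x → [ key x ℕ.<? key m ])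

    rank-mono : ∀ {m m′} → key m < key m′ → rank m < rank m′
    rank-mono {m} {m′} lt = ∑-mono-< (allFin n)
      (λ x → []-mono (_ ℕ.<? _) (_ ℕ.<? _) λ x< → ℕ.<-trans x< lt) (∈.∈-allFin m)
      (subst₂ _<_ (sym ([]-no (_ ℕ.<? _) (ℕ.<-irrefl refl))) (sym ([]-yes (_ ℕ.<? _) lt)) z<s)

    []≤1 : ∀ {P : Set} (d : Dec P) → [ d ] ≤ 1
    []≤1 (yes _) = s≤s z≤n
    []≤1 (no _)  = z≤n

    rank-< : ∀ m → rank m < n
    rank-< m = subst (rank m <_) (∑-1 n) (∑-mono-< (allFin n) (λ x → []≤1 (_ ℕ.<? _)) (∈.∈-allFin m)
      (subst (_< 1) (sym ([]-no (_ ℕ.<? _) (ℕ.<-irrefl refl))) z<s))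

    rank-injective : ∀ {m m′} → rank m ≡ rank m′ → m ≡ m′
    rank-injective {m} {m′} eq with ℕ.<-cmp (key m) (key m′)
    ... | tri< lt _ _ = contradiction eq (ℕ.<⇒≢ (rank-mono lt))
    ... | tri≈ _ e _  = key-injective e
    ... | tri> _ _ gt = contradiction (sym eq) (ℕ.<⇒≢ (rank-mono gt))

    below : ℕ → ℕ
    below i = ∑ (allFin n) (λ m → [ block m ℕ.<? i ])

    below-prefix : ∀ {i} → i ≤ length c → below i ≡ sum (List.take i c)
    below-prefix {zero}  _  = ∑-ε (allFin n) λ m _ → []-no (block m ℕ.<? 0) λ ()
    below-prefix {suc i} lt = begin
      below (suc i)                         ≡⟨ ∑-cong (allFin n) (λ m _ → pointwise (block m)) ⟩
      _                                     ≡⟨ ∑-∙ (allFin n) (λ m → [ block m ℕ.<? i ]) _ ⟩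
      below i + occurrences b i             ≡⟨ cong₂ _+_ (below-prefix (ℕ.<⇒≤ lt)) (ty lt) ⟩
      sum (List.take i c) + nth c i         ≡⟨ sum-take-suc c i ⟨
      sum (List.take (suc i) c)             ∎
      where
      open ≡-Reasoning
      pointwise : ∀ x → [ x ℕ.<? suc i ] ≡ [ x ℕ.<? i ] + [ x ℕ.≟ i ]
      pointwise x with ℕ.<-cmp x i
      ... | tri< lt ne _ rewrite []-yes (x ℕ.<? suc i) (ℕ.m≤n⇒m≤1+n lt)
          | []-yes (x ℕ.<? i) lt | []-no (x ℕ.≟ i) ne = refl
      ... | tri≈ ¬lt eq _ rewrite []-yes (x ℕ.<? suc i) (s≤s (ℕ.≤-reflexive eq))
          | []-no (x ℕ.<? i) ¬lt | []-yes (x ℕ.≟ i) eq = refl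
      ... | tri> ¬lt ne gt rewrite []-no (x ℕ.<? suc i) (ℕ.<⇒≱ (s≤s gt))
          | []-no (x ℕ.<? i) ¬lt | []-no (x ℕ.≟ i) ne = refl

    -- The rank of `m` is at least the number of elements in earlier blocks, and below that number
    -- plus the size of its own block; both bounds are prefix sums of `c`.
    rank-row : ∀ m → rowOf c (rank m) ≡ block m
    rank-row m = rowOf-prefix c (block m)
      (subst (_≤ rank m) (below-prefix (ℕ.<⇒≤ (Fin.toℕ<n (lookup b m))))
        (∑-mono-≤ (allFin n) λ x → []-mono (_ ℕ.<? _) (_ ℕ.<? _) key-<))
      (subst (rank m <_) (below-prefix (Fin.toℕ<n (lookup b m)))
        (∑-mono-< (allFin n)
          (λ x → []-mono (_ ℕ.<? _) (_ ℕ.<? _) λ lt → s≤s (key-block (ℕ.<⇒≤ lt)))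
          (∈.∈-allFin m)
          (subst₂ _<_ (sym ([]-no (_ ℕ.<? _) (ℕ.<-irrefl refl)))
                      (sym ([]-yes (_ ℕ.<? _) (ℕ.n<1+n (block m)))) z<s)))

    ranks : Vec (Fin n) n
    ranks = tabulate (λ m → Fin.fromℕ< (rank-< m))

    lookup-ranks : ∀ m → toℕ (lookup ranks m) ≡ rank m
    lookup-ranks m = trans (cong toℕ (Vec.lookup∘tabulate _ m)) (Fin.toℕ-fromℕ< (rank-< m))

    ranks-perm : IsPerm ranks
    ranks-perm m m′ eq =
      rank-injective (trans (sym (lookup-ranks m)) (trans (cong toℕ eq) (lookup-ranks m′)))

    α : Vec (Fin n) n
    α = tabulate (position ranks)

    rank-α : ∀ j → rank (lookup α j) ≡ toℕ j
    rank-α j = begin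
      rank (lookup α j)                            ≡⟨ lookup-ranks (lookup α j) ⟨
      toℕ (lookup ranks (lookup α j))              ≡⟨ cong (toℕ ∘ lookup ranks) (Vec.lookup∘tabulate (position ranks) j) ⟩
      toℕ (lookup ranks (position ranks j))        ≡⟨ cong toℕ (lookup-position ranks ranks-perm j) ⟩
      toℕ j                                        ∎
      where open ≡-Reasoning

    α-perm : IsPerm α
    α-perm i j eq = Fin.toℕ-injective (trans (sym (rank-α i)) (trans (cong rank eq) (rank-α j)))

    α-isSigma : IsSigma α c b
    α-isSigma j = trans (sym (rank-row (lookup α j))) (cong (rowOf c) (rank-α j))

    α-rows : ∀ {i j} → toℕ i ≤ toℕ j → row i ≡ row j → toℕ (lookup α i) ≤ toℕ (lookup α j)
    α-rows {i} {j} le eq = ℕ.≮⇒≥ λ lt → contradiction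
      (subst₂ _<_ (rank-α j) (rank-α i) (rank-mono (later lt))) (ℕ.≤⇒≯ le)
      where
      later : toℕ (lookup α j) < toℕ (lookup α i) → key (lookup α j) < key (lookup α i)
      later lt = subst (λ z → key (lookup α j) < z * n + toℕ (lookup α i))
        (trans (α-isSigma j) (trans (sym eq) (sym (α-isSigma i))))
        (ℕ.+-monoʳ-< (block (lookup α j) * n) lt)

    w : ℕ → ℕ
    w = nth (word α)

    -- The only way for the row word to fail `RowStandard`: inside rows it increases by
    -- construction.
    BadStep : ℕ → Set
    BadStep p = suc p < n × rowOf c p ≢ rowOf c (suc p) × w p ≤ w (suc p)

    -- Rows increase, so the letter at `p` is the maximum of its block and the letter at `suc p` the
    -- minimum of the next one; comparing these two compares all elements of the blocks.
    badStep⇒ascent : ∀ {p} → BadStep p → ∃ (AscentAt b)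
    badStep⇒ascent {p} (p+1<n , row≢ , w≤) = i , ascent
      where
      pᶠ p⁺ : Fin n
      pᶠ = Fin.fromℕ< (ℕ.<-trans (ℕ.n<1+n p) p+1<n)
      p⁺ = Fin.fromℕ< p+1<n
      toℕ-p : toℕ pᶠ ≡ p
      toℕ-p = Fin.toℕ-fromℕ< _
      toℕ-p⁺ : toℕ p⁺ ≡ suc p
      toℕ-p⁺ = Fin.toℕ-fromℕ< _
      step : rowOf c (suc p) ≡ suc (rowOf c p)
      step with suc p ∈? partialSums c
      ... | yes p∈ = rowOf-step∈ c>0 p∈
      ... | no p∉  = contradiction (sym (rowOf-step∉ c (subst (suc p <_) (sym sum≡n) p+1<n) p∉)) row≢
      row-p⁺ : row p⁺ ≡ suc (rowOf c p)
      row-p⁺ = trans (cong (rowOf c) toℕ-p⁺) step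
      i<r : rowOf c p < length cs
      i<r = ℕ.≤-pred (subst (_< length c) row-p⁺ (row-< p⁺))
      i : Fin (length cs)
      i = Fin.fromℕ< i<r
      αp≤αp⁺ : toℕ (lookup α pᶠ) ≤ toℕ (lookup α p⁺)
      αp≤αp⁺ = subst₂ _≤_ (trans (cong w (sym toℕ-p)) (nth-toList α pᶠ))
                          (trans (cong w (sym toℕ-p⁺)) (nth-toList α p⁺)) w≤
      ascent : AscentAt b i
      ascent m m′ bm bm′ = ℕ.≤∧≢⇒< m≤m′ λ e → ℕ.1+n≢n (trans (sym bm′)
                             (trans (cong block (sym (Fin.toℕ-injective e))) bm))
        where
        open ℕ.≤-Reasoning
        j j′ : Fin n
        j  = position α m
        j′ = position α m′
        αj : lookup α j ≡ m
        αj = lookup-position α α-perm m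
        αj′ : lookup α j′ ≡ m′
        αj′ = lookup-position α α-perm m′
        row-j : row j ≡ rowOf c p
        row-j = trans (sym (α-isSigma j)) (trans (cong block αj) (trans bm (Fin.toℕ-fromℕ< i<r)))
        row-j′ : row j′ ≡ suc (rowOf c p)
        row-j′ = trans (sym (α-isSigma j′)) (trans (cong block αj′) (trans bm′ (cong suc (Fin.toℕ-fromℕ< i<r))))
        j≤p : toℕ j ≤ toℕ pᶠ
        j≤p = subst (toℕ j ≤_) (sym toℕ-p) (ℕ.≮⇒≥ λ lt → ℕ.1+n≰n
          (subst₂ _≤_ step row-j (rowOf-mono c lt)))
        p⁺≤j′ : toℕ p⁺ ≤ toℕ j′
        p⁺≤j′ = subst (_≤ toℕ j′) (sym toℕ-p⁺) (ℕ.≰⇒> λ le → ℕ.1+n≰n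
          (subst (_≤ rowOf c p) row-j′ (rowOf-mono c le)))
        m≤m′ : toℕ m ≤ toℕ m′
        m≤m′ = begin
          toℕ m                ≡⟨ cong toℕ αj ⟨
          toℕ (lookup α j)     ≤⟨ α-rows j≤p (trans row-j (cong (rowOf c) (sym toℕ-p))) ⟩
          toℕ (lookup α pᶠ)    ≤⟨ αp≤αp⁺ ⟩
          toℕ (lookup α p⁺)    ≤⟨ α-rows p⁺≤j′ (trans row-p⁺ (sym row-j′)) ⟩
          toℕ (lookup α j′)    ≡⟨ cong toℕ αj′ ⟩
          toℕ m′               ∎

    no-badStep⇒standard : (∀ {p} → p < n → ¬ BadStep p) → Standard α
    no-badStep⇒standard good = RowStandard⇒standard α-perm λ p p+1<len →
      let p+1<n = subst (suc p <_) (length-word α) p+1<len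
          p<n   = ℕ.<-trans (ℕ.n<1+n p) p+1<n
          pᶠ    = Fin.fromℕ< p<n
          p⁺    = Fin.fromℕ< p+1<n
          e     = Fin.toℕ-fromℕ< p<n
          e⁺    = Fin.toℕ-fromℕ< p+1<n
      in (λ r → subst₂ _≤_ (trans (sym (nth-toList α pᶠ)) (cong w e))
                           (trans (sym (nth-toList α p⁺)) (cong w e⁺))
                  (α-rows (subst₂ _≤_ (sym e) (sym e⁺) (ℕ.n≤1+n p))
                          (trans (cong (rowOf c) e) (trans r (cong (rowOf c) (sym e⁺)))))) ,
         (λ r → ℕ.≰⇒> λ le → good p<n (p+1<n , r , le))

    standard-or-ascent : (∃ λ α → Standard α × IsSigma α c b) ⊎ ∃ (AscentAt b)
    standard-or-ascent with ℕ.anyUpTo? badStep? n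
      where
      badStep? : ∀ p → Dec (BadStep p)
      badStep? p = (suc p ℕ.<? n) ×-dec (¬? (rowOf c p ℕ.≟ rowOf c (suc p)) ×-dec (w p ℕ.≤? w (suc p)))
    ... | yes (p , _ , bad) = inj₂ (badStep⇒ascent bad)
    ... | no none           = inj₁ (α , no-badStep⇒standard (λ p<n bad → none (_ , p<n , bad)) , α-isSigma)

-- Signs of permutations composed with an adjacent transposition

inversion? : ∀ {n} (γ : Vec (Fin n) n) (p : Fin n × Fin n) →
  Dec ((proj₁ p Fin.< proj₂ p) × (lookup γ (proj₂ p) Fin.< lookup γ (proj₁ p)))
inversion? γ p = (proj₁ p Fin.<? proj₂ p) ×-dec (lookup γ (proj₂ p) Fin.<? lookup γ (proj₁ p))

module _ where
  open ℕ-Sum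

  inversions-∑ : ∀ {n} (γ : Vec (Fin n) n) →
    inversions γ ≡ ∑ (cartesianProduct (allFin n) (allFin n)) (λ p → [ inversion? γ p ])
  inversions-∑ γ = length-filter (inversion? γ) (cartesianProduct (allFin _) (allFin _))

  inversions-identity : ∀ n → inversions (Vec.allFin n) ≡ 0
  inversions-identity n = trans (inversions-∑ (Vec.allFin n))
    (∑-ε (cartesianProduct (allFin n) (allFin n)) λ (i , j) _ →
       []-no (inversion? (Vec.allFin n) (i , j)) λ (lt , inv) →
         ℕ.<⇒≯ lt (subst₂ Fin._<_ (Vec.lookup-allFin j) (Vec.lookup-allFin i) inv))

module AdjacentSwap {n : ℕ} (s t : Fin n) (adjacent : toℕ t ≡ suc (toℕ s)) where
  open ℕ-Sum

  private
    s≢t : s ≢ t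
    s≢t e = ℕ.1+n≢n (trans (sym adjacent) (cong toℕ (sym e)))

    _≟ₚ_ : DecidableEquality (Fin n × Fin n)
    _≟ₚ_ = Product.≡-dec Fin._≟_ Fin._≟_

    pairs : List (Fin n × Fin n)
    pairs = cartesianProduct (allFin n) (allFin n)

  τ : Fin n → Fin n
  τ x with x Fin.≟ s | x Fin.≟ t
  ... | yes _ | _     = t
  ... | no _  | yes _ = s
  ... | no _  | no _  = x

  τ-s : τ s ≡ t
  τ-s with s Fin.≟ s | s Fin.≟ t
  ... | yes _ | _ = refl
  ... | no ne | _ = contradiction refl ne

  τ-t : τ t ≡ s
  τ-t with t Fin.≟ s | t Fin.≟ t
  ... | yes e | _     = contradiction (sym e) s≢t
  ... | no _  | yes _ = refl
  ... | no _  | no ne = contradiction refl ne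

  τ-other : ∀ {x} → x ≢ s → x ≢ t → τ x ≡ x
  τ-other {x} x≢s x≢t with x Fin.≟ s | x Fin.≟ t
  ... | yes e | _     = contradiction e x≢s
  ... | no _  | yes e = contradiction e x≢t
  ... | no _  | no _  = refl

  τ-cases : ∀ {P : Fin n → Set} → P s → P t → (∀ {x} → x ≢ s → x ≢ t → P x) → ∀ x → P x
  τ-cases {P} ps pt other x with x Fin.≟ s | x Fin.≟ t
  ... | yes refl | _        = ps
  ... | no _     | yes refl = pt
  ... | no x≢s   | no x≢t   = other x≢s x≢t

  τ-involutive : ∀ x → τ (τ x) ≡ x
  τ-involutive = τ-cases (trans (cong τ τ-s) τ-t) (trans (cong τ τ-t) τ-s)
    λ x≢s x≢t → trans (cong τ (τ-other x≢s x≢t)) (τ-other x≢s x≢t)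

  -- Nothing lies strictly between `s` and `t`, so their exchange reverses no other pair.
  τ-mono : ∀ i j → toℕ i < toℕ j → ¬ (i ≡ s × j ≡ t) → toℕ (τ i) < toℕ (τ j)
  τ-mono i j lt ne with i Fin.≟ s | i Fin.≟ t | j Fin.≟ s | j Fin.≟ t
  ... | yes refl | _        | yes refl | _        = contradiction lt (ℕ.<-irrefl refl)
  ... | yes i≡s  | _        | no _     | yes j≡t  = contradiction (i≡s , j≡t) ne
  ... | yes refl | _        | no _     | no j≢t   =
    ℕ.≤∧≢⇒< (subst (_≤ toℕ j) (sym adjacent) lt) (λ e → j≢t (Fin.toℕ-injective (sym e)))
  ... | no _     | yes refl | yes refl | _        =
    contradiction lt (ℕ.<⇒≯ (ℕ.≤-reflexive (sym adjacent)))
  ... | no _     | yes refl | no _     | yes refl = contradiction lt (ℕ.<-irrefl refl)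
  ... | no _     | yes refl | no _     | no _     =
    ℕ.<-trans (ℕ.≤-reflexive (sym adjacent)) lt
  ... | no _     | no _     | yes refl | _        =
    ℕ.<-trans lt (ℕ.≤-reflexive (sym adjacent))
  ... | no i≢s   | no _     | no _     | yes refl =
    ℕ.≤∧≢⇒< (ℕ.≤-pred (subst (toℕ i <_) adjacent lt)) (i≢s ∘ Fin.toℕ-injective)
  ... | no _     | no _     | no _     | no _     = lt

  swap : Vec (Fin n) n
  swap = tabulate τ

  lookup-∘-swap : (γ : Vec (Fin n) n) → ∀ j → lookup (γ ∘ₚ swap) j ≡ lookup γ (τ j)
  lookup-∘-swap γ j = trans (lookup-∘ₚ γ swap j) (cong (lookup γ) (Vec.lookup∘tabulate τ j))

  swap-involutive : ∀ γ → (γ ∘ₚ swap) ∘ₚ swap ≡ γ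
  swap-involutive γ = vec-ext λ j →
    trans (lookup-∘-swap (γ ∘ₚ swap) j) (trans (lookup-∘-swap γ (τ j)) (cong (lookup γ) (τ-involutive j)))

  ∘-swap-perm : ∀ γ → IsPerm γ → IsPerm (γ ∘ₚ swap)
  ∘-swap-perm γ perm = ∘ₚ-perm γ swap perm λ i j eq → trans (sym (τ-involutive i))
    (trans (cong τ (trans (sym (Vec.lookup∘tabulate τ i)) (trans eq (Vec.lookup∘tabulate τ j))))
           (τ-involutive j))

  -- Reindexing pairs by `τ` in both coordinates matches the inversions of `γ ∘ₚ swap` with those of
  -- `γ`, except for the new inversion at positions `(s , t)`, which is the image of the index
  -- `(t , s)`.
  inversions-swap : ∀ γ → lookup γ s Fin.< lookup γ t → inversions (γ ∘ₚ swap) ≡ suc (inversions γ)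
  inversions-swap γ asc = begin
    inversions (γ ∘ₚ swap)
      ≡⟨ inversions-∑ (γ ∘ₚ swap) ⟩
    ∑ pairs (λ p → [ inversion? (γ ∘ₚ swap) p ])
      ≡⟨ ∑-bijection _≟ₚ_ pairs-unique pairs-unique ττ ττ (λ p _ → pairs-∈ (ττ p)) (λ p _ → pairs-∈ (ττ p))
           ττ-involutive (λ p _ → ττ-involutive p) (λ p → [ inversion? (γ ∘ₚ swap) p ]) ⟨
    ∑ pairs (λ p → [ inversion? (γ ∘ₚ swap) (ττ p) ])
      ≡⟨ ∑-cong pairs (λ p _ → pointwise p) ⟩
    ∑ pairs (λ p → [ p ≟ₚ (t , s) ] + [ inversion? γ p ])
      ≡⟨ ∑-∙ pairs (λ p → [ p ≟ₚ (t , s) ]) _ ⟩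
    ∑ pairs (λ p → [ p ≟ₚ (t , s) ]) + ∑ pairs (λ p → [ inversion? γ p ])
      ≡⟨ cong₂ _+_ (trans (∑-single pairs-unique (pairs-∈ (t , s)) λ p _ ne → []-no (p ≟ₚ (t , s)) ne)
                          ([]-yes ((t , s) ≟ₚ (t , s)) refl))
                   (sym (inversions-∑ γ)) ⟩
    suc (inversions γ) ∎
    where
    open ≡-Reasoning
    pairs-unique : Unique pairs
    pairs-unique = Unique.cartesianProduct⁺ (Unique.allFin⁺ n) (Unique.allFin⁺ n)
    pairs-∈ : ∀ p → p ∈ pairs
    pairs-∈ p = ∈.∈-cartesianProduct⁺ (∈.∈-allFin _) (∈.∈-allFin _)
    ττ : Fin n × Fin n → Fin n × Fin n
    ττ (i , j) = τ i , τ j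
    ττ-involutive : ∀ p → ττ (ττ p) ≡ p
    ττ-involutive (i , j) = cong₂ _,_ (τ-involutive i) (τ-involutive j)
    s<t : s Fin.< t
    s<t = ℕ.≤-reflexive (sym adjacent)
    unswap : ∀ i → lookup (γ ∘ₚ swap) (τ i) ≡ lookup γ i
    unswap i = trans (lookup-∘-swap γ (τ i)) (cong (lookup γ) (τ-involutive i))
    pointwise : ∀ p → [ inversion? (γ ∘ₚ swap) (ττ p) ] ≡ [ p ≟ₚ (t , s) ] + [ inversion? γ p ]
    pointwise p@(i , j) with p ≟ₚ (t , s)
    ... | yes refl = trans ([]-yes (inversion? (γ ∘ₚ swap) (ττ p))
        (subst₂ Fin._<_ (sym τ-t) (sym τ-s) s<t ,
         subst₂ Fin._<_ (sym (unswap s)) (sym (unswap t)) asc))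
      (cong suc (sym ([]-no (inversion? γ (t , s)) λ (lt , _) → ℕ.<⇒≯ s<t lt)))
    ... | no ne with p ≟ₚ (s , t)
    ...   | yes refl = trans
      ([]-no (inversion? (γ ∘ₚ swap) (ττ p)) λ (lt , _) → ℕ.<⇒≯ s<t (subst₂ Fin._<_ τ-s τ-t lt))
      (sym ([]-no (inversion? γ (s , t)) λ (_ , desc) → ℕ.<⇒≯ asc desc))
    ...   | no ne′ = []-⇔ (inversion? (γ ∘ₚ swap) (ττ p)) (inversion? γ p)
      (λ (lt , inv) →
         subst₂ Fin._<_ (τ-involutive i) (τ-involutive j)
           (τ-mono (τ i) (τ j) lt λ (ei , ej) → ne (cong₂ _,_
              (trans (sym (τ-involutive i)) (trans (cong τ ei) τ-s))
              (trans (sym (τ-involutive j)) (trans (cong τ ej) τ-t)))) ,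
         subst₂ Fin._<_ (unswap j) (unswap i) inv)
      (λ (lt , inv) →
         τ-mono i j lt (λ (ei , ej) → ne′ (cong₂ _,_ ei ej)) ,
         subst₂ Fin._<_ (sym (unswap j)) (sym (unswap i)) inv)

youngSubgroup-unique : ∀ n c → Unique (youngSubgroup n c)
youngSubgroup-unique n c = Unique.filter⁺ (inYoung? c) (Unique.filter⁺ isPerm? (allOSP-unique n n))

∈-youngSubgroup : ∀ {n} c (γ : Vec (Fin n) n) → IsPerm γ → InYoung c γ → γ ∈ youngSubgroup n c
∈-youngSubgroup c γ perm young = ∈.∈-filter⁺ (inYoung? c) (∈.∈-filter⁺ isPerm? (allOSP-∈ γ) perm) young

youngSubgroup⇒ : ∀ {n} c {γ : Vec (Fin n) n} → γ ∈ youngSubgroup n c → IsPerm γ × InYoung c γ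
youngSubgroup⇒ {n} c γ∈ =
  let γ∈perms , young = ∈.∈-filter⁻ (inYoung? c) {xs = allPerms n} γ∈
  in proj₂ (∈.∈-filter⁻ isPerm? {xs = allOSP n n} γ∈perms) , young

-- Linear algebra over the field

module FieldSums {a ℓ : Level} (F : Field a ℓ) where
  open Field F public
    using (Carrier; _≈_; 0#; 1#; ring; +-commutativeMonoid; setoid;
           +-cong; +-congˡ; +-congʳ; +-identityˡ; +-identityʳ; +-assoc; +-comm; -‿cong; -‿inverseʳ;
           *-cong; *-congˡ; *-congʳ; *-identityˡ; *-identityʳ; *-assoc; *-comm; zeroˡ; zeroʳ;
           distribˡ; distribʳ)
    renaming (_+_ to _⊕_; _*_ to _⊗_; -_ to ⊖_; _-_ to _⊝_; refl to ≈-refl; sym to ≈-sym; trans to ≈-trans; reflexive to ≈-reflexive)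
  open RingProperties ring public using (-‿distribˡ-*; -‿distribʳ-*; -‿involutive; -0#≈0#)
  open ListSum +-commutativeMonoid public
  open import Relation.Binary.Reasoning.Setoid setoid

  private variable
    A : Set

  ⊝-zero : ∀ {x y} → x ≈ 0# → y ≈ 0# → x ⊝ y ≈ 0#
  ⊝-zero x≈0 y≈0 = ≈-trans (+-cong x≈0 (≈-trans (-‿cong y≈0) -0#≈0#)) (+-identityˡ 0#)

  ⊗-zeroˡ : ∀ {x y} → x ≈ 0# → x ⊗ y ≈ 0#
  ⊗-zeroˡ x≈0 = ≈-trans (*-congʳ x≈0) (zeroˡ _)

  ⊗-zeroʳ : ∀ {x y} → y ≈ 0# → x ⊗ y ≈ 0#
  ⊗-zeroʳ y≈0 = ≈-trans (*-congˡ y≈0) (zeroʳ _)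

  ind-yes : ∀ {P : Set} (d : Dec P) → P → ind F d ≈ 1#
  ind-yes (yes _) _ = ≈-refl
  ind-yes (no ¬p) p = contradiction p ¬p

  ind-no : ∀ {P : Set} (d : Dec P) → ¬ P → ind F d ≈ 0#
  ind-no (yes p) ¬p = contradiction p ¬p
  ind-no (no _)  _  = ≈-refl

  signPow-cancel : ∀ m {x} → signPow F m ⊗ x ≈ 0# → x ≈ 0#
  signPow-cancel zero    eq = ≈-trans (≈-sym (*-identityˡ _)) eq
  signPow-cancel (suc m) eq = signPow-cancel m (≈-trans (≈-sym (-‿involutive _))
    (≈-trans (-‿cong (≈-trans (-‿distribˡ-* _ _) eq)) -0#≈0#))

  ∑-distribˡ : ∀ x (ys : List A) f → x ⊗ ∑ ys f ≈ ∑ ys (λ y → x ⊗ f y)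
  ∑-distribˡ x []       f = zeroʳ x
  ∑-distribˡ x (y ∷ ys) f = ≈-trans (distribˡ x _ _) (+-congˡ (∑-distribˡ x ys f))

  -- A sign-reversing involution. The predicate `P` selects one element of each orbit; showing only
  -- that the sum equals its own negative would prove nothing in characteristic 2.
  ∑-cancel : DecidableEquality A → ∀ {xs : List A} → Unique xs →
    (τ : A → A) → (∀ x → x ∈ xs → τ x ∈ xs) → (∀ x → τ (τ x) ≡ x) →
    {P : A → Set} → (∀ x → Dec (P x)) →
    (∀ x → x ∈ xs → P x → ¬ P (τ x)) → (∀ x → x ∈ xs → ¬ P x → P (τ x)) →
    ∀ f → (∀ x → x ∈ xs → P x → f (τ x) ≈ ⊖ f x) → ∑ xs f ≈ 0#
  ∑-cancel _≟_ {xs} unique τ τ∈ ττ P? ¬Pτ Pτ f odd = begin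
    ∑ xs f                             ≈⟨ ∑-cong xs (λ x _ → halves x) ⟩
    ∑ xs (λ x → up x ⊕ down x)         ≈⟨ ∑-∙ xs up down ⟩
    ∑ xs up ⊕ ∑ xs down                ≈⟨ +-congˡ (∑-bijection _≟_ unique unique τ τ τ∈ τ∈ ττ (λ x _ → ττ x) down) ⟨
    ∑ xs up ⊕ ∑ xs (down ∘ τ)          ≈⟨ +-congˡ (∑-cong xs flip) ⟩
    ∑ xs up ⊕ ∑ xs (λ x → ⊖ up x)      ≈⟨ ∑-∙ xs up (λ x → ⊖ up x) ⟨
    ∑ xs (λ x → up x ⊕ ⊖ up x)         ≈⟨ ∑-ε xs (λ x _ → -‿inverseʳ (up x)) ⟩
    0#                                 ∎
    where
    up down : _ → Carrier
    up x with P? x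
    ... | yes _ = f x
    ... | no _  = 0#
    down x with P? x
    ... | yes _ = 0#
    ... | no _  = f x
    halves : ∀ x → f x ≈ up x ⊕ down x
    halves x with P? x
    ... | yes _ = ≈-sym (+-identityʳ _)
    ... | no _  = ≈-sym (+-identityˡ _)
    flip : ∀ x → x ∈ xs → down (τ x) ≈ ⊖ up x
    flip x x∈ with P? x | P? (τ x)
    ... | yes p | yes q = contradiction q (¬Pτ x x∈ p)
    ... | yes p | no _  = odd x x∈ p
    ... | no ¬p | yes _ = ≈-sym -0#≈0#
    ... | no ¬p | no ¬q = contradiction (Pτ x x∈ ¬p) ¬q

  ∑-telescope : ∀ x y → x ⊕ (y ⊝ x) ≈ y
  ∑-telescope x y = begin
    x ⊕ (y ⊕ ⊖ x)   ≈⟨ +-congˡ (+-comm y (⊖ x)) ⟩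
    x ⊕ (⊖ x ⊕ y)   ≈⟨ +-assoc x (⊖ x) y ⟨
    (x ⊕ ⊖ x) ⊕ y   ≈⟨ +-congʳ (-‿inverseʳ x) ⟩
    0# ⊕ y          ≈⟨ +-identityˡ y ⟩
    y               ∎

  -- Distinct elements with equal keys also fall under `off-diagonal`, so `key` need not separate
  -- elements.
  module Unitriangular {A : Set} {xs : List A} (unique : Unique xs) (key : A → ℕ) (M : A → A → Carrier)
    (diagonal : ∀ x → x ∈ xs → M x x ≈ 1#)
    (off-diagonal : ∀ x y → x ∈ xs → y ∈ xs → x ≢ y → ¬ (key x < key y) → M x y ≈ 0#) where

    -- In the equation at `y`, terms with smaller key vanish by induction on the key and the others
    -- by triangularity; only `l y` remains.
    independent : ∀ (l : A → Carrier) → (∀ y → y ∈ xs → ∑ xs (λ x → l x ⊗ M x y) ≈ 0#) → ∀ y → y ∈ xs → l y ≈ 0#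
    independent l eq y y∈ = go (suc (key y)) y y∈ ℕ.≤-refl
      where
      go : ∀ N y → y ∈ xs → key y < N → l y ≈ 0#
      go (suc N) y y∈ (s≤s y≤N) = begin
        l y                            ≈⟨ *-identityʳ (l y) ⟨
        l y ⊗ 1#                       ≈⟨ *-congˡ (diagonal y y∈) ⟨
        l y ⊗ M y y                    ≈⟨ ∑-single unique y∈ others ⟨
        ∑ xs (λ x → l x ⊗ M x y)       ≈⟨ eq y y∈ ⟩
        0#                             ∎
        where
        others : ∀ x → x ∈ xs → x ≢ y → l x ⊗ M x y ≈ 0#
        others x x∈ x≢y with key x ℕ.<? key y
        ... | yes lt = ⊗-zeroˡ (go N x x∈ (ℕ.<-≤-trans lt y≤N))
        ... | no ¬lt = ⊗-zeroʳ (off-diagonal x y x∈ y∈ x≢y ¬lt)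

    module _ (v : A → Carrier) where
      private
        -- Forward substitution: `approx N` solves the equations with key below `N`. The correction
        -- puts the residue on the elements of key `N`, and triangularity keeps it out of the
        -- equations already solved.
        approx correction : ℕ → A → Carrier
        approx zero    x = 0#
        approx (suc N) x = approx N x ⊕ correction N x
        correction N x with key x ℕ.≟ N
        ... | yes _ = v x ⊝ ∑ xs (λ x′ → approx N x′ ⊗ M x′ x)
        ... | no _  = 0#

        correction-≡ : ∀ {N x} → key x ≡ N → correction N x ≈ v x ⊝ ∑ xs (λ x′ → approx N x′ ⊗ M x′ x)
        correction-≡ {N} {x} eq with key x ℕ.≟ N
        ... | yes _ = ≈-refl
        ... | no ne = contradiction eq ne

        correction-others : ∀ N {x y} → x ∈ xs → y ∈ xs → x ≢ y → key y ≤ N →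
                            correction N x ⊗ M x y ≈ 0#
        correction-others N {x} {y} x∈ y∈ x≢y y≤N with key x ℕ.≟ N
        ... | no _     = zeroˡ _
        ... | yes refl = ⊗-zeroʳ (off-diagonal x y x∈ y∈ x≢y (ℕ.≤⇒≯ y≤N))

        approx-solves : ∀ N y → y ∈ xs → key y < N → ∑ xs (λ x → approx N x ⊗ M x y) ≈ v y
        approx-solves (suc N) y y∈ (s≤s y≤N) = begin
          ∑ xs (λ x → (approx N x ⊕ correction N x) ⊗ M x y)
            ≈⟨ ∑-cong xs (λ x _ → distribʳ (M x y) (approx N x) (correction N x)) ⟩
          ∑ xs (λ x → approx N x ⊗ M x y ⊕ correction N x ⊗ M x y)
            ≈⟨ ∑-∙ xs _ _ ⟩
          ∑ xs (λ x → approx N x ⊗ M x y) ⊕ ∑ xs (λ x → correction N x ⊗ M x y)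
            ≈⟨ +-congˡ (∑-single unique y∈ λ x x∈ x≢y → correction-others N x∈ y∈ x≢y y≤N) ⟩
          ∑ xs (λ x → approx N x ⊗ M x y) ⊕ correction N y ⊗ M y y
            ≈⟨ +-congˡ (≈-trans (*-congˡ (diagonal y y∈)) (*-identityʳ _)) ⟩
          ∑ xs (λ x → approx N x ⊗ M x y) ⊕ correction N y
            ≈⟨ last (ℕ.m≤n⇒m<n∨m≡n y≤N) ⟩
          v y ∎
          where
          last : key y < N ⊎ key y ≡ N → ∑ xs (λ x → approx N x ⊗ M x y) ⊕ correction N y ≈ v y
          last (inj₂ eq) = ≈-trans (+-congˡ (correction-≡ eq)) (∑-telescope _ (v y))
          last (inj₁ lt) with key y ℕ.≟ N
          ... | yes eq = contradiction eq (ℕ.<⇒≢ lt)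
          ... | no _   = ≈-trans (+-identityʳ _) (approx-solves N y y∈ lt)

        bound : ∀ ys → ∃ λ N → ∀ (x : A) → x ∈ ys → key x < N
        bound []       = 0 , λ _ ()
        bound (y ∷ ys) with bound ys
        ... | N , below = suc (key y) ℕ.⊔ N , λ
          { x (here refl) → ℕ.m≤m⊔n _ N
          ; x (there x∈)  → ℕ.<-≤-trans (below x x∈) (ℕ.m≤n⊔m _ N) }

      solvable : ∃ λ l → ∀ y → y ∈ xs → ∑ xs (λ x → l x ⊗ M x y) ≈ v y
      solvable = let N , below = bound xs in
        approx N , λ y y∈ → approx-solves N y y∈ (below y y∈)

-- Chains, boundaries and the vanishing of cycles

module _ {a ℓ : Level} (F : Field a ℓ) {n x₀ : ℕ} {cs : List ℕ}
         (c>0 : All (0 <_) (x₀ ∷ cs)) (sum≡n : sum (x₀ ∷ cs) ≡ n) where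
  open FieldSums F
  open Tabloids c>0 sum≡n
  open import Relation.Binary.Reasoning.Setoid setoid

  private
    _≟ᵥ_ : ∀ {n r} → DecidableEquality (Vec (Fin r) n)
    _≟ᵥ_ = Vec.≡-dec Fin._≟_

    Chainₙ : ℕ → Set a
    Chainₙ r = Chain F n r

    -- The share of the merge at `i` in the incidence number of `b` in the boundary of `x`.
    coefficient : ∀ {r} → OSP n r → OSP n (suc r) → Fin r → Carrier
    coefficient b x i = signPow F (toℕ i) ⊗ ind F (Vec.map (pinch i) x ≟ᵥ b)

  ∂-cong : ∀ {r} {x y : Chainₙ (suc r)} → (∀ b → x b ≈ y b) → ∀ b → ∂ F x b ≈ ∂ F y b
  ∂-cong {r} eq b = ∑-cong (allOSP n (suc r)) λ a _ → ∑-cong (allFin r) λ i _ → *-congˡ (eq a)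

  ∂-linear : ∀ {r} (x : Chainₙ (suc r)) l (y : Chainₙ (suc r)) b →
             ∂ F (λ a → x a ⊕ l ⊗ y a) b ≈ ∂ F x b ⊕ l ⊗ ∂ F y b
  ∂-linear {r} x l y b = begin
    ∑ (allOSP n (suc r)) (λ a → ∑ (allFin r) (λ i → coefficient b a i ⊗ (x a ⊕ l ⊗ y a)))
      ≈⟨ ∑-cong (allOSP n (suc r)) (λ a _ → ≈-trans (∑-cong (allFin r) λ i _ →
           ≈-trans (distribˡ (coefficient b a i) (x a) _) (+-congˡ (exchange (coefficient b a i) (y a))))
           (≈-trans (∑-∙ (allFin r) _ _) (+-congˡ (≈-sym (∑-distribˡ l (allFin r) _))))) ⟩
    ∑ (allOSP n (suc r)) (λ a → ∑ (allFin r) (λ i → coefficient b a i ⊗ x a) ⊕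
                                l ⊗ ∑ (allFin r) (λ i → coefficient b a i ⊗ y a))
      ≈⟨ ∑-∙ (allOSP n (suc r)) _ _ ⟩
    ∂ F x b ⊕ ∑ (allOSP n (suc r)) (λ a → l ⊗ ∑ (allFin r) (λ i → coefficient b a i ⊗ y a))
      ≈⟨ +-congˡ (≈-sym (∑-distribˡ l (allOSP n (suc r)) _)) ⟩
    ∂ F x b ⊕ l ⊗ ∂ F y b ∎
    where
    exchange : ∀ k z → k ⊗ (l ⊗ z) ≈ l ⊗ (k ⊗ z)
    exchange k z = ≈-trans (≈-sym (*-assoc k l z)) (≈-trans (*-congʳ (*-comm k l)) (*-assoc l k z))

  Cycle : ∀ {r} → Chainₙ (suc r) → Set ℓ
  Cycle x = ∀ b → ∂ F x b ≈ 0#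

  zero-cycle : ∀ {r} → Cycle {r} (λ _ → 0#)
  zero-cycle {r} b = ∑-ε (allOSP n (suc r)) λ a _ → ∑-ε (allFin r) λ i _ → zeroʳ (coefficient b a i)

  linear-cycle : ∀ {r} (x : Chainₙ (suc r)) l (y : Chainₙ (suc r)) →
                 Cycle x → Cycle y → Cycle (λ a → x a ⊕ l ⊗ y a)
  linear-cycle x l y cx cy b = ≈-trans (∂-linear x l y b)
    (≈-trans (+-cong (cx b) (⊗-zeroʳ (cy b))) (+-identityˡ 0#))

  ∑-cycle : ∀ {r} {A : Set} (xs : List A) (l : A → Carrier) (h : A → Chainₙ (suc r)) →
            (∀ x → x ∈ xs → Cycle (h x)) → Cycle (λ b → ∑ xs (λ x → l x ⊗ h x b))
  ∑-cycle []       l h ch = zero-cycle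
  ∑-cycle (x ∷ xs) l h ch b =
    ≈-trans (∂-cong (λ a → +-comm (l x ⊗ h x a) _) b)
      (linear-cycle (λ b → ∑ xs (λ x → l x ⊗ h x b)) (l x) (h x)
        (∑-cycle xs l h (λ y y∈ → ch y (there y∈))) (ch x (here refl)) b)

  ⊝-cycle : ∀ {r} (x y : Chainₙ (suc r)) → Cycle x → Cycle y → Cycle (λ a → x a ⊝ y a)
  ⊝-cycle x y cx cy b = ≈-trans
    (∂-cong (λ a → +-congˡ (≈-trans (-‿cong (≈-sym (*-identityˡ (y a)))) (-‿distribˡ-* 1# (y a)))) b)
    (linear-cycle x (⊖ 1#) y cx cy b)

  IsBoundary⇒zero : {z : Chainₙ (length c)} → IsBoundary F c z → ∀ b → z b ≈ 0#
  IsBoundary⇒zero (w , w-chain , ∂w≈z) b = ≈-trans (≈-sym (∂w≈z b))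
    (≈-trans (∂-cong {y = λ _ → 0#} (λ a → w-chain a (no-higher-faces a)) b) (zero-cycle b))

  zero⇒IsBoundary : {z : Chainₙ (length c)} → (∀ b → z b ≈ 0#) → IsBoundary F c z
  zero⇒IsBoundary z≈0 =
    (λ _ → 0#) , (λ _ _ → ≈-refl) , λ b → ≈-trans (zero-cycle b) (≈-sym (z≈0 b))

  cycle-determined : (z : Chainₙ (length c)) → IsChainOf F c z → Cycle z →
    (∀ α → Standard α → z (σ α) ≈ 0#) → ∀ b → z b ≈ 0#
  cycle-determined z chain cycle vanish b = go (suc (value b)) b ℕ.≤-refl
    where
    go : ∀ N b → value b < N → z b ≈ 0#
    go (suc N) b (s≤s b≤N) with inΔ? b
    ... | no ¬ty = chain b ¬ty
    ... | yes inΔ with RowWord.standard-or-ascent b (InΔ⇒HasType b inΔ)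
    ...   | inj₁ (α , std , s) =
      subst (λ b → z b ≈ 0#)
        (isSigma-unique α (standard⇒perm std) (σ α) b (σ-isSigma α (standard⇒perm std)) s)
        (vanish α std)
    -- In the boundary at `merged` only the term of `b` and `i` survives. Block sizes determine the
    -- merge index, and any other face of the complex merging to `merged` precedes `b`, so the
    -- recursion applies to it.
    ...   | inj₂ (i , ascent) = signPow-cancel (toℕ i) (begin
      signPow F (toℕ i) ⊗ z b
        ≈⟨ *-congʳ (≈-trans (*-congˡ (ind-yes (Vec.map (pinch i) b ≟ᵥ merged) refl)) (*-identityʳ _)) ⟨
      coefficient merged b i ⊗ z b
        ≈⟨ ∑-single (Unique.allFin⁺ _) (∈.∈-allFin i) (λ j _ j≢i → other-index j j≢i) ⟨
      ∑ (allFin (length cs)) (λ j → coefficient merged b j ⊗ z b)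
        ≈⟨ ∑-single (allOSP-unique n (length c)) (allOSP-∈ b)
             (λ a _ a≢b → ∑-ε (allFin (length cs)) λ j _ → other-face a a≢b j) ⟨
      ∂ F z merged
        ≈⟨ cycle merged ⟩
      0# ∎)
      where
      merged : OSP n (length cs)
      merged = Vec.map (pinch i) b
      ty : HasType b
      ty = InΔ⇒HasType b inΔ
      other-index : ∀ j → j ≢ i → coefficient merged b j ⊗ z b ≈ 0#
      other-index j j≢i = ⊗-zeroˡ (⊗-zeroʳ (ind-no (Vec.map (pinch j) b ≟ᵥ merged)
        (j≢i ∘ merged-index-unique b b ty ty)))
      other-face : ∀ a → a ≢ b → ∀ j → coefficient merged a j ⊗ z a ≈ 0#
      other-face a a≢b j with inΔ? a | Vec.map (pinch j) a ≟ᵥ merged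
      ... | no ¬Δ  | _      = ⊗-zeroʳ (chain a ¬Δ)
      ... | yes aΔ | no ne  = ⊗-zeroˡ (zeroʳ _)
      ... | yes aΔ | yes eq with merged-index-unique a b (InΔ⇒HasType a aΔ) ty eq
      ...   | refl = ⊗-zeroʳ (go N a (ℕ.<-≤-trans
        (≺⇒value-< a b (resplit-≺ a b (InΔ⇒HasType a aΔ) ty ascent eq a≢b)) b≤N))

  private
    Young : List (Vec (Fin n) n)
    Young = youngSubgroup n c

  -- The chains `g` are cycles

  module _ (α : Vec (Fin n) n) (perm : IsPerm α) where
    g-chain : IsChainOf F c (g F c α)
    g-chain b b∉Δ = ∑-ε Young λ γ γ∈ → ⊗-zeroʳ (ind-no (isSigma? (α ∘ₚ γ) c b) λ s →
      b∉Δ (HasType⇒InΔ b (isSigma⇒HasType (α ∘ₚ γ)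
        (∘ₚ-perm α γ perm (proj₁ (youngSubgroup⇒ c γ∈))) b s)))

    module _ (b : OSP n (length cs)) (i : Fin (length cs)) where
      private
        end : ∃ λ p → suc p ∈ partialSums c × rowOf c p ≡ toℕ i × suc p < sum c
        end = row-end c>0 (s<s (Fin.toℕ<n i))
        p : ℕ
        p = proj₁ end
        p∈ : suc p ∈ partialSums c
        p∈ = proj₁ (proj₂ end)
        p+1<n : suc p < n
        p+1<n = subst (suc p <_) sum≡n (proj₂ (proj₂ (proj₂ end)))
        s t : Fin n
        s = Fin.fromℕ< (ℕ.<-trans (ℕ.n<1+n p) p+1<n)
        t = Fin.fromℕ< p+1<n
        toℕ-s : toℕ s ≡ p
        toℕ-s = Fin.toℕ-fromℕ< _
        toℕ-t : toℕ t ≡ suc p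
        toℕ-t = Fin.toℕ-fromℕ< _
        row-s : row s ≡ toℕ i
        row-s = trans (cong (rowOf c) toℕ-s) (proj₁ (proj₂ (proj₂ end)))
        row-t : row t ≡ suc (toℕ i)
        row-t = trans (cong (rowOf c) toℕ-t)
          (trans (rowOf-step∈ c>0 p∈) (cong suc (proj₁ (proj₂ (proj₂ end)))))
        col-s≡col-t : col s ≡ col t
        col-s≡col-t = trans (cong (colOf c ∘ suc) toℕ-s)
          (sym (trans (cong (colOf c ∘ suc) toℕ-t) (colOf-step∈ c p∈)))

      open AdjacentSwap s t (trans toℕ-t (cong suc (sym toℕ-s)))

      -- The positions `s` and `t` lie on both sides of a row border, hence in one column.
      swap-young : ∀ γ → γ ∈ Young → γ ∘ₚ swap ∈ Young
      swap-young γ γ∈ = let γ-perm , young = youngSubgroup⇒ c γ∈ in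
        ∈-youngSubgroup c (γ ∘ₚ swap) (∘-swap-perm γ γ-perm) λ j →
          trans (cong col (lookup-∘-swap γ j)) (trans (young (τ j)) (col-τ j))
        where
        col-τ : ∀ j → col (τ j) ≡ col j
        col-τ = τ-cases (trans (cong col τ-s) (sym col-s≡col-t)) (trans (cong col τ-t) col-s≡col-t)
          λ j≢s j≢t → cong col (τ-other j≢s j≢t)

      -- The swap exchanges one element of block `i` with one of the next block, and the merge at
      -- `i` forgets the difference.
      pinch-swap : ∀ β → IsPerm β → Vec.map (pinch i) (σ (β ∘ₚ swap)) ≡ Vec.map (pinch i) (σ β)
      pinch-swap β β-perm = vec-ext λ m →
        trans (Vec.lookup-map m (pinch i) (σ (β ∘ₚ swap)))
          (trans (same m) (sym (Vec.lookup-map m (pinch i) (σ β))))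
        where
        β′-perm : IsPerm (β ∘ₚ swap)
        β′-perm = ∘-swap-perm β β-perm
        block : ∀ j → toℕ (lookup (σ β) (lookup β j)) ≡ row j
        block = σ-isSigma β β-perm
        block′ : ∀ j → toℕ (lookup (σ (β ∘ₚ swap)) (lookup β j)) ≡ row (τ j)
        block′ j = trans (cong (toℕ ∘ lookup (σ (β ∘ₚ swap))) (sym
            (trans (lookup-∘-swap β (τ j)) (cong (lookup β) (τ-involutive j)))))
          (σ-isSigma (β ∘ₚ swap) β′-perm (τ j))
        at : ∀ j → pinch i (lookup (σ (β ∘ₚ swap)) (lookup β j)) ≡ pinch i (lookup (σ β) (lookup β j))
        at = τ-cases
          (sym (pinch-adjacent i _ _ (trans (block s) row-s) (trans (block′ s) (trans (cong row τ-s) row-t))))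
          (pinch-adjacent i _ _ (trans (block′ t) (trans (cong row τ-t) row-s)) (trans (block t) row-t))
          (λ {j} j≢s j≢t → cong (pinch i) (Fin.toℕ-injective
             (trans (block′ j) (trans (cong row (τ-other j≢s j≢t)) (sym (block j))))))
        same : ∀ m → pinch i (lookup (σ (β ∘ₚ swap)) m) ≡ pinch i (lookup (σ β) m)
        same m = subst (λ m → pinch i (lookup (σ (β ∘ₚ swap)) m) ≡ pinch i (lookup (σ β) m))
          (lookup-position β β-perm m) (at (position β m))

      -- The involution is composition with `swap`; from each pair `P` selects the `γ` that ascends
      -- from `s` to `t`, the case in which `inversions-swap` applies.
      merged-terms-cancel : ∑ Young (λ γ → coefficient b (σ (α ∘ₚ γ)) i ⊗ sign F γ) ≈ 0#
      merged-terms-cancel = ∑-cancel _≟ᵥ_ (youngSubgroup-unique n c) (_∘ₚ swap) swap-young swap-involutive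
        {λ γ → lookup γ s Fin.< lookup γ t} (λ γ → lookup γ s Fin.<? lookup γ t)
        (λ γ _ lt lt′ → ℕ.<⇒≯ lt (subst₂ Fin._<_ (at-s γ) (at-t γ) lt′))
        (λ γ γ∈ ≮ → subst₂ Fin._<_ (sym (at-s γ)) (sym (at-t γ)) (ℕ.≤∧≢⇒< (ℕ.≮⇒≥ ≮)
           λ e → ℕ.1+n≢n (trans (sym toℕ-t) (trans (cong toℕ
              (proj₁ (youngSubgroup⇒ c γ∈) t s (Fin.toℕ-injective e))) toℕ-s))))
        (λ γ → coefficient b (σ (α ∘ₚ γ)) i ⊗ sign F γ)
        λ γ γ∈ asc → begin
          coefficient b (σ (α ∘ₚ (γ ∘ₚ swap))) i ⊗ sign F (γ ∘ₚ swap)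
            ≈⟨ *-cong (≈-reflexive (cong (λ x → signPow F (toℕ i) ⊗ ind F (x ≟ᵥ b))
                 (trans (cong (Vec.map (pinch i) ∘ σ) (∘-assoc γ))
                        (pinch-swap (α ∘ₚ γ) (∘ₚ-perm α γ perm (proj₁ (youngSubgroup⇒ c γ∈)))))))
                 (≈-reflexive (cong (signPow F) (inversions-swap γ asc))) ⟩
          coefficient b (σ (α ∘ₚ γ)) i ⊗ (⊖ sign F γ)
            ≈⟨ -‿distribʳ-* _ _ ⟨
          ⊖ (coefficient b (σ (α ∘ₚ γ)) i ⊗ sign F γ) ∎
        where
        at-s : ∀ γ → lookup (γ ∘ₚ swap) s ≡ lookup γ t
        at-s γ = trans (lookup-∘-swap γ s) (cong (lookup γ) τ-s)
        at-t : ∀ γ → lookup (γ ∘ₚ swap) t ≡ lookup γ s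
        at-t γ = trans (lookup-∘-swap γ t) (cong (lookup γ) τ-t)
        ∘-assoc : ∀ γ → α ∘ₚ (γ ∘ₚ swap) ≡ (α ∘ₚ γ) ∘ₚ swap
        ∘-assoc γ = vec-ext λ j → trans (lookup-∘ₚ α (γ ∘ₚ swap) j)
          (trans (cong (lookup α) (lookup-∘ₚ γ swap j))
            (sym (trans (lookup-∘ₚ (α ∘ₚ γ) swap j) (lookup-∘ₚ α γ (lookup swap j)))))

    -- The transposition depends on the merged border, so the sum over merge indices is moved
    -- outermost and the cancellation is done for each `i` separately.
    g-cycle : Cycle (g F c α)
    g-cycle b = begin
      ∑ faces (λ x → ∑ indices (λ i → coefficient b x i ⊗ g F c α x))
        ≈⟨ ∑-cong faces (λ x _ → ∑-cong indices λ i _ → ∑-distribˡ (coefficient b x i) Young _) ⟩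
      ∑ faces (λ x → ∑ indices (λ i → ∑ Young (term x i)))
        ≈⟨ ∑-swap faces indices _ ⟩
      ∑ indices (λ i → ∑ faces (λ x → ∑ Young (term x i)))
        ≈⟨ ∑-cong indices (λ i _ → ∑-swap faces Young (λ x → term x i)) ⟩
      ∑ indices (λ i → ∑ Young (λ γ → ∑ faces (λ x → term x i γ)))
        ≈⟨ ∑-ε indices (λ i _ → ≈-trans (∑-cong Young (only-σ i)) (merged-terms-cancel b i)) ⟩
      0# ∎
      where
      faces : List (OSP n (length c))
      faces = allOSP n (length c)
      indices : List (Fin (length cs))
      indices = allFin (length cs)
      term : OSP n (length c) → Fin (length cs) → Vec (Fin n) n → Carrier
      term x i γ = coefficient b x i ⊗ (sign F γ ⊗ ind F (isSigma? (α ∘ₚ γ) c x))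
      only-σ : ∀ i γ → γ ∈ Young →
               ∑ faces (λ x → term x i γ) ≈ coefficient b (σ (α ∘ₚ γ)) i ⊗ sign F γ
      only-σ i γ γ∈ = ≈-trans
        (∑-single (allOSP-unique n (length c)) (allOSP-∈ (σ (α ∘ₚ γ))) λ x _ x≢σ →
           ⊗-zeroʳ (⊗-zeroʳ (ind-no (isSigma? (α ∘ₚ γ) c x) λ s →
             x≢σ (isSigma-unique (α ∘ₚ γ) β-perm x (σ (α ∘ₚ γ)) s (σ-isSigma (α ∘ₚ γ) β-perm)))))
        (*-congˡ (≈-trans (*-congˡ (ind-yes (isSigma? (α ∘ₚ γ) c (σ (α ∘ₚ γ)))
                                            (σ-isSigma (α ∘ₚ γ) β-perm)))
                          (*-identityʳ _)))
        where
        β-perm : IsPerm (α ∘ₚ γ)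
        β-perm = ∘ₚ-perm α γ perm (proj₁ (youngSubgroup⇒ c γ∈))

  -- The triangular system and the basis

  private
    standards : List (Vec (Fin n) n)
    standards = withDescentComposition n c

    standards-unique : Unique standards
    standards-unique = Unique.filter⁺ _ (Unique.filter⁺ isPerm? (allOSP-unique n n))

  -- By `σ-stabilizer` only the identity contributes, and it has no inversions.
  g-diagonal : ∀ α → Standard α → g F c α (σ α) ≈ 1#
  g-diagonal α std = begin
    ∑ Young (λ γ → sign F γ ⊗ ind F (isSigma? (α ∘ₚ γ) c (σ α)))
      ≈⟨ ∑-single (youngSubgroup-unique n c) identity∈ (λ γ γ∈ γ≢id →
           ⊗-zeroʳ (ind-no (isSigma? (α ∘ₚ γ) c (σ α)) λ s →
             let γ-perm , young = youngSubgroup⇒ c γ∈ in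
             γ≢id (σ-stabilizer std γ γ-perm young s))) ⟩
    sign F identity ⊗ ind F (isSigma? (α ∘ₚ identity) c (σ α))
      ≈⟨ *-cong (≈-reflexive (cong (signPow F) (inversions-identity n)))
                (ind-yes (isSigma? (α ∘ₚ identity) c (σ α)) α-sigma) ⟩
    1# ⊗ 1#
      ≈⟨ *-identityˡ 1# ⟩
    1# ∎
    where
    identity : Vec (Fin n) n
    identity = Vec.allFin n
    identity∈ : identity ∈ Young
    identity∈ = ∈-youngSubgroup c identity
      (λ i j eq → trans (sym (Vec.lookup-allFin i)) (trans eq (Vec.lookup-allFin j)))
      (λ j → cong col (Vec.lookup-allFin j))
    α-sigma : IsSigma (α ∘ₚ identity) c (σ α)
    α-sigma j = trans (cong (toℕ ∘ lookup (σ α)) (trans (lookup-∘ₚ α identity j)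
                                                        (cong (lookup α) (Vec.lookup-allFin j))))
                      (σ-isSigma α (standard⇒perm std) j)

  -- A contributing `γ` would make `σ β` a face of `g α`; it differs from `σ α` by
  -- `standard-unique`, so `σ-minimal` would place it after `σ α`.
  g-off-diagonal : ∀ α β → Standard α → Standard β → α ≢ β →
                   ¬ (value (σ α) < value (σ β)) → g F c α (σ β) ≈ 0#
  g-off-diagonal α β stdα stdβ α≢β ≮ = ∑-ε Young λ γ γ∈ →
    ⊗-zeroʳ (ind-no (isSigma? (α ∘ₚ γ) c (σ β)) λ s →
      let γ-perm , young = youngSubgroup⇒ c γ∈ in
      ≮ (≺⇒value-< (σ α) (σ β) (σ-minimal stdα γ γ-perm young (σ β) s λ σβ≡σα →
        α≢β (standard-unique stdα stdβ (σ α) (σ-isSigma α (standard⇒perm stdα))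
          (subst (IsSigma β c) σβ≡σα (σ-isSigma β (standard⇒perm stdβ)))))))

  open Unitriangular standards-unique (value ∘ σ) (λ α β → g F c α (σ β)) g-diagonal g-off-diagonal

  combo-chain : ∀ l → IsChainOf F c (combo F c l)
  combo-chain l b b∉Δ = ∑-ε standards λ α std → ⊗-zeroʳ (g-chain α (standard⇒perm std) b b∉Δ)

  homologyBasis : IsHomologyBasis F n c
  homologyBasis =
    (λ α std → g-chain α (standard⇒perm std) , g-cycle α (standard⇒perm std)) ,
    (λ z z-chain z-cycle →
      -- The coefficients make the combination agree with `z` on all leading faces, so the
      -- difference is a cycle that vanishes there, hence everywhere.
      let l , solves = solvable (z ∘ σ) in
      l , zero⇒IsBoundary (cycle-determined (λ b → z b ⊝ combo F c l b)
        (λ b b∉Δ → ⊝-zero (z-chain b b∉Δ) (combo-chain l b b∉Δ))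
        (⊝-cycle z (combo F c l) z-cycle
          (∑-cycle standards l (g F c) λ α std → g-cycle α (standard⇒perm std)))
        λ α std → ≈-trans (+-congˡ (-‿cong (solves α std))) (-‿inverseʳ (z (σ α))))) ,
    -- A boundary in this degree is zero; its values at the leading faces are the homogeneous
    -- triangular system.
    (λ l boundary → independent l λ β _ → IsBoundary⇒zero boundary (σ β))

theorem6p6 : {c ℓ : Level} (F : Field c ℓ) (n : ℕ) (cc : List ℕ) →
    IsPositiveComposition n cc →
    IsHomologyBasis F n cc
theorem6p6 F n []       (nonempty , _)        = contradiction refl nonempty
theorem6p6 F n (x ∷ cs) comp@(_ , sum≡n , _) = homologyBasis F (positive (x ∷ cs) comp) sum≡n
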